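{- Let $d_1 \geq d_2 \geq \cdots \geq d_m \geq 2$ be integers that form the degree sequence of some tree. Among all trees whose degree sequence is $(d_1,\dots,d_m)$, the greedy tree with degree sequence $(d_1,\dots,d_m)$ has the maximum number of subtrees.
   Context: All trees are finite. A subtree of a tree $T$ is a nonempty connected subgraph of $T$; $f(T)$ denotes the number of subtrees of $T$. The degree sequence of a tree is the multiset of degrees of its non-leaf vertices, listed in non-increasing order (the number of leaves is then determined). The greedy tree with degree sequence $d_1 \geq d_2 \geq \cdots \geq d_m$ is the rooted tree built as follows: the root $r$ receives degree $d_1$ and gets $d_1$ children $r_1, r_2, \dots$, which receive the next largest available degrees with $d(r_1)\ge d(r_2)\ge\cdots$; then the children of $r_1$ are labelled $r_{11}, r_{12},\dots$ and receive the largest degrees still available with $d(r_{11})\ge d(r_{12})\ge \cdots$, then the same is done for the children of $r_2$, $r_3$, and so on; this is repeated level by level, always processing next the already-labelled vertex of largest degree whose children have not yet been assigned degrees (equivalently, the degrees $d_2,d_3,\dots$ are assigned in non-increasing order along the breadth-first order of the vertices, a non-root vertex of degree $d$ having $d-1$ children). Once all of $d_1,\dots,d_m$ are used, all remaining vertices are leaves. -}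

module Defs where

open import Data.Nat using (ℕ; zero; suc; _+_; _*_; _∸_; _≤_; _<_; _≤ᵇ_; _<ᵇ_)
open import Data.Bool using (Bool; true; false; _∧_; _∨_; T)
open import Data.Fin using (Fin; toℕ)
open import Data.Fin.Subset using (Subset; _∈_; Nonempty; ⊤)
open import Data.List using (List; []; _∷_; length; map; take; filterᵇ; allFin)
open import Data.Nat.ListAction using (sum)
open import Data.List.Relation.Binary.Permutation.Propositional using (_↭_)
open import Data.Product using (_×_)
open import Relation.Binary.PropositionalEquality using (_≡_)

Graph : ℕ → Set
Graph n = Fin n → Fin n → Bool

module _ {n : ℕ} (G : Graph n) where

  deg : Fin n → ℕ
  deg v = length (filterᵇ (G v) (allFin n))

  numEdges : ℕ
  numEdges = sum (map (λ i → length (filterᵇ (λ j → (toℕ i <ᵇ toℕ j) ∧ G i j) (allFin n))) (allFin n))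

  data WalkIn (S : Subset n) : Fin n → Fin n → Set where
    here : ∀ {u} → u ∈ S → WalkIn S u u
    step : ∀ {u w v} → u ∈ S → T (G u w) → WalkIn S w v → WalkIn S u v

  ConnectedIn : Subset n → Set
  ConnectedIn S = ∀ u v → u ∈ S → v ∈ S → WalkIn S u v

  IsTree : Set
  IsTree = (∀ u → G u u ≡ false)
         × (∀ u v → G u v ≡ G v u)
         × (1 ≤ n)
         × ConnectedIn ⊤
         × (numEdges ≡ n ∸ 1)

  HasDegSeq : List ℕ → Set
  HasDegSeq ds = map deg (filterᵇ (λ v → 2 ≤ᵇ deg v) (allFin n)) ↭ ds

  -- a subtree: a nonempty vertex set inducing a connected subgraph
  -- (proofs are irrelevant, so a subtree is determined by its vertex set)
  record Subtree : Set where
    constructor subtree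
    field
      vertices : Subset n
      .nonempty : Nonempty vertices
      .connected : ConnectedIn vertices

-- Greedy tree.  Vertices are numbered 0,1,...,N-1 in breadth-first order.
-- Vertex 0 (root) gets d₁ children, vertex j (1 ≤ j < m) gets d_{j+1} - 1
-- children, all other vertices are leaves.  Children are numbered
-- consecutively: vertex i ≥ 1 is a child of j iff C(j-1) < i ≤ C(j),
-- where C(j) = c₀ + ... + c_j is the cumulative number of children.

childCounts : List ℕ → List ℕ
childCounts []       = []
childCounts (d ∷ ds) = d ∷ map (λ x → x ∸ 1) ds

greedySize : List ℕ → ℕ
greedySize ds = suc (sum (childCounts ds))

isChildOf : List ℕ → ℕ → ℕ → Bool
isChildOf ds i j = (sum (take j (childCounts ds)) <ᵇ i) ∧ (i ≤ᵇ sum (take (suc j) (childCounts ds)))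

greedyTree : (ds : List ℕ) → Graph (greedySize ds)
greedyTree ds u v = isChildOf ds (toℕ u) (toℕ v) ∨ isChildOf ds (toℕ v) (toℕ u)

{-# OPTIONS --safe #-}
module Submission where

-- Give each leaf a weight and count every subtree with the product of its leaf
-- weights.  In a tree maximising this count for given degrees and leaf weights,
-- let v be the internal vertex contained in the fewest subtrees.  Then v has at
-- most one internal neighbour, and exchanging branches between v and any other
-- vertex shows that v has the smallest degree and carries the lightest leaves.
-- Replacing v and its leaves w₁, …, w_k by a single leaf of weight
-- (1 + w₁) ⋯ (1 + w_k) changes the count by w₁ + ⋯ + w_k, so by induction the
-- maximum is given by a Huffman-like merging of the leaves.  Starting from unit
-- weights each merged leaf is the heaviest so far, so the merging follows the
-- reversed breadth-first order of the greedy tree, which attains the maximum.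

open import Defs
open import Data.Bool using (Bool; true; false; T; _∧_; _∨_)
import Data.Bool.Properties as Bool
open import Data.Bool.Properties using (∨-comm; T-∧; T-∨; ∧-zeroʳ; ∨-zeroʳ)
open import Data.Empty using (⊥; ⊥-elim)
open import Data.Fin as Fin using (Fin; zero; suc)
import Data.Fin.Properties as Fin
open import Data.Fin.Subset using (Subset; inside; outside; ⊤; ⁅_⁆; Nonempty) renaming (_∈_ to _∈ˢ_; _∉_ to _∉ˢ_; ⊥ to ∅)
open import Data.Fin.Subset.Properties using (∈⊤; x∈⁅x⁆; x∈⁅y⁆⇒x≡y; _∈?_; ⊆-antisym)
open import Data.List using (List; []; _∷_; _++_; length; map; filter; filterᵇ; lookup; take; drop; reverse; replicate; concatMap; allFin; upTo; downFrom)
open import Data.List.Membership.DecPropositional using () renaming (_∈?_ to member?)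
open import Data.List.Membership.Propositional using (_∈_; _∉_; find; lose)
open import Data.List.Membership.Propositional.Properties
open import Data.List.Properties using (++-assoc; ++-identityʳ; length-++; length-map; length-take; length-drop; length-tabulate; map-++; map-∘; map-cong; map-cong-local; map-applyUpTo; map-upTo; map-tabulate; take++drop≡id; take-all; filter-++; filter-accept; unfold-reverse; reverse-map; reverse-upTo)
open import Data.List.Relation.Binary.Permutation.Propositional renaming (trans to compose)
open import Data.List.Relation.Binary.Permutation.Propositional.Properties hiding (++-assoc; ++-identityʳ; sum-↭; product-↭)
open import Data.List.Relation.Binary.Permutation.Setoid.Properties using (Unique-resp-↭)
open import Data.List.Relation.Binary.Pointwise using (Pointwise-≡⇒≡)
open import Data.List.Relation.Unary.All as All using (All; []; _∷_)
import Data.List.Relation.Unary.All.Properties as All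
open import Data.List.Relation.Unary.AllPairs as AllPairs using (AllPairs; []; _∷_)
import Data.List.Relation.Unary.AllPairs.Properties as AllPairs
open import Data.List.Relation.Unary.Any using (here; there; index; any?)
open import Data.List.Relation.Unary.Any.Properties using (lookup-index)
open import Data.List.Relation.Unary.Linked using (Linked)
open import Data.List.Relation.Unary.Linked.Properties using (AllPairs⇒Linked; Linked⇒AllPairs)
open import Data.List.Relation.Unary.Sorted.TotalOrder.Properties using (↗↭↗⇒≋)
open import Data.List.Relation.Unary.Unique.Propositional using (Unique)
import Data.List.Relation.Unary.Unique.Propositional.Properties as Unique
open import Data.Nat
open import Data.Nat.ListAction using (sum; product)
open import Data.Nat.ListAction.Properties using (sum-++; sum-↭; product-++; product-↭)
open import Data.Nat.Properties
open import Data.List.Sort ≤-decTotalOrder using (sort; sort-↭; sort-↗)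
open import Data.Nat.Tactic.RingSolver using (solve-∀)
open import Data.Product using (Σ; _×_; _,_; ∃; ∃₂; proj₁; proj₂)
open import Data.Sum using (_⊎_; inj₁; inj₂)
open import Data.Vec as Vec using ([]; _∷_; _[_]≔_; here; there)
open import Data.Vec.Functional using (updateAt)
open import Data.Vec.Functional.Properties using (updateAt-updates; updateAt-minimal)
import Data.Vec.Properties as Vec
open import Function using (_∘_)
open import Function.Bundles using (_↔_; Inverse; Equivalence)
open import Relation.Binary.PropositionalEquality hiding ([_])
open import Relation.Nullary using (¬_; ¬?; yes; no; contradiction; recompute; _×-dec_)
open import Relation.Nullary.Decidable using (decidable-stable; T?)

-- Trees with weighted leaves

-- Weights close the class of trees under contraction: a contracted star becomes a leaf through
-- which several subtrees pass. Choosing the vertex v in the fewest subtrees fixes the sign of every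
-- exchange. If v carries branches with joint factor α and another vertex y carries branches with
-- joint factor β, swapping them gains (α - β)(Y - X), where αX and βY count the subtrees that
-- contain only v or only y. Minimality of v means αX ≤ βY, so β < α would force X < Y and hence a
-- gain. The same comparison across an edge excludes two internal neighbours of v: each would have
-- to surpass the other. Only weak inequalities come out, so ties remain; they are harmless because
-- degrees and weights are compared as multisets. On graphs the matching operation is the removal of
-- a pendant vertex of weight w: it costs w and multiplies the weight of its neighbour by 1 + w.
-- This one recurrence both turns an arbitrary tree graph into a weighted tree and evaluates the
-- greedy tree as a sequence of merges.

data Tree : Set where
  leaf : ℕ → Tree
  node : List Tree → Tree

Π⁺ : List ℕ → ℕ
Π⁺ xs = product (map suc xs)

-- The weighted number of subtrees through the top vertex. Each branch offers a factor
-- `suc (rooted t)`, the `suc` being the choice to leave the branch out. A leaf of weight `w` stands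
-- for a collapsed piece with `w` subtrees through its top.
rooted  : Tree → ℕ
rooted* : List Tree → ℕ
rooted (leaf w)  = w
rooted (node ts) = rooted* ts
rooted* []       = 1
rooted* (t ∷ ts) = suc (rooted t) * rooted* ts

total  : Tree → ℕ
total* : List Tree → ℕ
total (leaf w)  = w
total (node ts) = rooted* ts + total* ts
total* []       = 0
total* (t ∷ ts) = total t + total* ts

degs  : Tree → List ℕ
degs* : List Tree → List ℕ
degs (leaf w)  = []
degs (node ts) = suc (length ts) ∷ degs* ts
degs* []       = []
degs* (t ∷ ts) = degs t ++ degs* ts

weights  : Tree → List ℕ
weights* : List Tree → List ℕ
weights (leaf w)  = w ∷ []
weights (node ts) = weights* ts
weights* []       = []
weights* (t ∷ ts) = weights t ++ weights* ts

-- A list of branches also stands for the tree with these branches at its root,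
-- which, unlike the other nodes, has no edge to a parent.
whole : List Tree → ℕ
whole ts = rooted* ts + total* ts

allDegs : List Tree → List ℕ
allDegs ts = length ts ∷ degs* ts

rooted*-↭ : ∀ {ts us} → ts ↭ us → rooted* ts ≡ rooted* us
rooted*-↭ refl = refl
rooted*-↭ (prep t p) = cong (suc (rooted t) *_) (rooted*-↭ p)
rooted*-↭ (swap {ts} {us} t u p) rewrite rooted*-↭ p = lemma (suc (rooted t)) (suc (rooted u)) (rooted* us)
  where lemma : ∀ a b c → a * (b * c) ≡ b * (a * c)
        lemma = solve-∀
rooted*-↭ (compose p q) = trans (rooted*-↭ p) (rooted*-↭ q)

total*-↭ : ∀ {ts us} → ts ↭ us → total* ts ≡ total* us
total*-↭ refl = refl
total*-↭ (prep t p) = cong (total t +_) (total*-↭ p)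
total*-↭ (swap {ts} {us} t u p) rewrite total*-↭ p = lemma (total t) (total u) (total* us)
  where lemma : ∀ a b c → a + (b + c) ≡ b + (a + c)
        lemma = solve-∀
total*-↭ (compose p q) = trans (total*-↭ p) (total*-↭ q)

concat-swap : ∀ {A : Set} (a b : List A) {c d} → c ↭ d → a ++ b ++ c ↭ b ++ a ++ d
concat-swap a b {c} {d} p = begin
  a ++ b ++ c    ↭⟨ ++⁺ˡ a (++⁺ˡ b p) ⟩
  a ++ b ++ d    ↭⟨ shifts a b ⟩
  b ++ a ++ d    ∎
  where open PermutationReasoning

degs*-↭ : ∀ {ts us} → ts ↭ us → degs* ts ↭ degs* us
degs*-↭ refl = refl
degs*-↭ (prep t p) = ++⁺ˡ (degs t) (degs*-↭ p)
degs*-↭ (swap t u p) = concat-swap (degs t) (degs u) (degs*-↭ p)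
degs*-↭ (compose p q) = compose (degs*-↭ p) (degs*-↭ q)

weights*-↭ : ∀ {ts us} → ts ↭ us → weights* ts ↭ weights* us
weights*-↭ refl = refl
weights*-↭ (prep t p) = ++⁺ˡ (weights t) (weights*-↭ p)
weights*-↭ (swap t u p) = concat-swap (weights t) (weights u) (weights*-↭ p)
weights*-↭ (compose p q) = compose (weights*-↭ p) (weights*-↭ q)

whole-↭ : ∀ {ts us} → ts ↭ us → whole ts ≡ whole us
whole-↭ p = cong₂ _+_ (rooted*-↭ p) (total*-↭ p)

allDegs-↭ : ∀ {ts us} → ts ↭ us → allDegs ts ↭ allDegs us
allDegs-↭ p = compose (prep _ (degs*-↭ p)) (↭-reflexive (cong (_∷ _) (↭-length p)))

rooted*-++ : ∀ ts us → rooted* (ts ++ us) ≡ rooted* ts * rooted* us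
rooted*-++ [] us = sym (+-identityʳ _)
rooted*-++ (t ∷ ts) us rewrite rooted*-++ ts us = sym (*-assoc (suc (rooted t)) (rooted* ts) (rooted* us))

total*-++ : ∀ ts us → total* (ts ++ us) ≡ total* ts + total* us
total*-++ [] us = refl
total*-++ (t ∷ ts) us rewrite total*-++ ts us = sym (+-assoc (total t) _ _)

degs*-++ : ∀ ts us → degs* (ts ++ us) ≡ degs* ts ++ degs* us
degs*-++ [] us = refl
degs*-++ (t ∷ ts) us rewrite degs*-++ ts us = sym (++-assoc (degs t) _ _)

weights*-++ : ∀ ts us → weights* (ts ++ us) ≡ weights* ts ++ weights* us
weights*-++ [] us = refl
weights*-++ (t ∷ ts) us rewrite weights*-++ ts us = sym (++-assoc (weights t) _ _)

rooted*-leaves : ∀ ws → rooted* (map leaf ws) ≡ Π⁺ ws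
rooted*-leaves [] = refl
rooted*-leaves (w ∷ ws) = cong (suc w *_) (rooted*-leaves ws)

total*-leaves : ∀ ws → total* (map leaf ws) ≡ sum ws
total*-leaves [] = refl
total*-leaves (w ∷ ws) = cong (w +_) (total*-leaves ws)

degs*-leaves : ∀ ws → degs* (map leaf ws) ≡ []
degs*-leaves [] = refl
degs*-leaves (w ∷ ws) = degs*-leaves ws

weights*-leaves : ∀ ws → weights* (map leaf ws) ≡ ws
weights*-leaves [] = refl
weights*-leaves (w ∷ ws) = cong (w ∷_) (weights*-leaves ws)

rooted*≥1 : ∀ ts → 1 ≤ rooted* ts
rooted*≥1 [] = ≤-refl
rooted*≥1 (t ∷ ts) = *-mono-≤ {1} {suc (rooted t)} (s≤s z≤n) (rooted*≥1 ts)

split-nodes-leaves : ∀ ts → ∃₂ λ uss ws → ts ↭ map node uss ++ map leaf ws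
split-nodes-leaves [] = [] , [] , refl
split-nodes-leaves (leaf w ∷ ts) with split-nodes-leaves ts
... | uss , ws , p = uss , w ∷ ws , compose (prep _ p) (↭-sym (shift (leaf w) (map node uss) (map leaf ws)))
split-nodes-leaves (node us ∷ ts) with split-nodes-leaves ts
... | uss , ws , p = us ∷ uss , ws , prep _ p

-- Rerooting and the exchange of branches

-- A path leads from a vertex down to a descendant; each step records the
-- siblings to the left and to the right of the child it enters.
Path : Set
Path = List (List Tree × List Tree)

plug : Path → List Tree → List Tree
plug []            zs = zs
plug ((l , r) ∷ q) zs = l ++ node (plug q zs) ∷ r

-- `up` holds the part of the tree above the current vertex, turned upside down: a step down makes
-- the old vertex, with all branches but the one entered, a single branch of the new one.
reroot : List Tree → Path → List Tree → List Tree
reroot up []            zs = up ++ zs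
reroot up ((l , r) ∷ q) zs = reroot (node (up ++ l ++ r) ∷ []) q zs

-- rooted* (plug q zs) and total* (plug q zs) are affine in rooted* zs.
rooted₀ rooted₁ total₀ total₁ : Path → ℕ
rooted₀ []            = 0
rooted₀ ((l , r) ∷ q) = rooted* (l ++ r) * suc (rooted₀ q)
rooted₁ []            = 1
rooted₁ ((l , r) ∷ q) = rooted* (l ++ r) * rooted₁ q
total₀ []             = 0
total₀ ((l , r) ∷ q)  = rooted₀ q + total₀ q + total* (l ++ r)
total₁ []             = 0
total₁ ((l , r) ∷ q)  = rooted₁ q + total₁ q

pathDegs pathWeights : Path → List ℕ
pathDegs []               = []
pathDegs ((l , r) ∷ q)    = suc (suc (length (l ++ r))) ∷ degs* (l ++ r) ++ pathDegs q
pathWeights []            = []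
pathWeights ((l , r) ∷ q) = weights* (l ++ r) ++ pathWeights q

rooted*-plug : ∀ q zs → rooted* (plug q zs) ≡ rooted₀ q + rooted₁ q * rooted* zs
rooted*-plug [] zs = sym (+-identityʳ _)
rooted*-plug ((l , r) ∷ q) zs
  rewrite rooted*-↭ (shift (node (plug q zs)) l r) | rooted*-plug q zs
  = lemma (rooted₀ q) (rooted₁ q) (rooted* zs) (rooted* (l ++ r))
  where lemma : ∀ c j z s → suc (c + j * z) * s ≡ s * suc c + s * j * z
        lemma = solve-∀

total*-plug : ∀ q zs → total* (plug q zs) ≡ total₀ q + total₁ q * rooted* zs + total* zs
total*-plug [] zs = refl
total*-plug ((l , r) ∷ q) zs
  rewrite total*-↭ (shift (node (plug q zs)) l r) | rooted*-plug q zs | total*-plug q zs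
  = lemma (rooted₀ q) (rooted₁ q) (total₀ q) (total₁ q) (rooted* zs) (total* zs) (total* (l ++ r))
  where lemma : ∀ c j e k z t s → c + j * z + (e + k * z + t) + s ≡ c + e + s + (j + k) * z + t
        lemma = solve-∀

shift-inner : ∀ {A : Set} (x : A) (up l r : List A) → up ++ l ++ x ∷ r ↭ x ∷ up ++ l ++ r
shift-inner x up l r = begin
  up ++ l ++ x ∷ r    ↭⟨ ++⁺ˡ up (shift x l r) ⟩
  up ++ x ∷ l ++ r    ↭⟨ shift x up (l ++ r) ⟩
  x ∷ up ++ l ++ r    ∎
  where open PermutationReasoning

degs-plug : ∀ q zs → degs (node (plug q zs)) ↭ pathDegs q ++ degs (node zs)
degs-plug [] zs = refl
degs-plug ((l , r) ∷ q) zs = begin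
  degs (node (l ++ node (plug q zs) ∷ r))
    ↭⟨ degs-node-↭ (shift (node (plug q zs)) l r) ⟩
  suc (suc (length (l ++ r))) ∷ degs (node (plug q zs)) ++ degs* (l ++ r)
    ↭⟨ prep _ (++-comm (degs (node (plug q zs))) (degs* (l ++ r))) ⟩
  suc (suc (length (l ++ r))) ∷ degs* (l ++ r) ++ degs (node (plug q zs))
    ↭⟨ prep _ (++⁺ˡ (degs* (l ++ r)) (degs-plug q zs)) ⟩
  suc (suc (length (l ++ r))) ∷ degs* (l ++ r) ++ pathDegs q ++ degs (node zs)
    ≡⟨ cong (_ ∷_) (++-assoc (degs* (l ++ r)) _ _) ⟨
  suc (suc (length (l ++ r))) ∷ (degs* (l ++ r) ++ pathDegs q) ++ degs (node zs) ∎
  where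
  open PermutationReasoning
  degs-node-↭ : ∀ {ts us} → ts ↭ us → degs (node ts) ↭ degs (node us)
  degs-node-↭ p = compose (prep _ (degs*-↭ p)) (↭-reflexive (cong (λ k → suc k ∷ _) (↭-length p)))

weights*-plug : ∀ q zs → weights* (plug q zs) ↭ pathWeights q ++ weights* zs
weights*-plug [] zs = refl
weights*-plug ((l , r) ∷ q) zs = begin
  weights* (l ++ node (plug q zs) ∷ r)               ↭⟨ weights*-↭ (shift (node (plug q zs)) l r) ⟩
  weights* (plug q zs) ++ weights* (l ++ r)          ↭⟨ ++-comm (weights* (plug q zs)) _ ⟩
  weights* (l ++ r) ++ weights* (plug q zs)          ↭⟨ ++⁺ˡ (weights* (l ++ r)) (weights*-plug q zs) ⟩
  weights* (l ++ r) ++ pathWeights q ++ weights* zs  ≡⟨ ++-assoc (weights* (l ++ r)) _ _ ⟨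
  (weights* (l ++ r) ++ pathWeights q) ++ weights* zs ∎
  where open PermutationReasoning

-- Each step moves the root across one edge, and the count is symmetric in the two sides of that
-- edge: subtrees using the edge contribute the product of the two rooted counts, the others stay on
-- one side.
whole-reroot : ∀ up q zs → whole (reroot up q zs) ≡ whole (up ++ plug q zs)
whole-reroot up [] zs = refl
whole-reroot up ((l , r) ∷ q) zs = begin
  whole (reroot (node (up ++ l ++ r) ∷ []) q zs)  ≡⟨ whole-reroot _ q zs ⟩
  whole (node (up ++ l ++ r) ∷ plug q zs)
    ≡⟨ lemma (rooted* (up ++ l ++ r)) (rooted* (plug q zs)) (total* (up ++ l ++ r)) (total* (plug q zs)) ⟩
  whole (node (plug q zs) ∷ up ++ l ++ r)         ≡⟨ whole-↭ (shift-inner (node (plug q zs)) up l r) ⟨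
  whole (up ++ l ++ node (plug q zs) ∷ r)         ∎
  where
  open ≡-Reasoning
  lemma : ∀ a b s t → suc a * b + (a + s + t) ≡ suc b * a + (b + t + s)
  lemma = solve-∀

-- Of the subtrees through the vertex at the end of the path, `total₁ q` accounts for those that
-- miss the old root and `rooted* up * rooted₁ q` for those that contain it; `rooted* zs` is their
-- common factor.
rooted*-reroot : ∀ up q zs → rooted* (reroot up q zs) ≡ rooted* zs * (total₁ q + rooted* up * rooted₁ q)
rooted*-reroot up [] zs = trans (rooted*-++ up zs) (lemma (rooted* up) (rooted* zs))
  where lemma : ∀ a b → a * b ≡ b * (a * 1)
        lemma = solve-∀
rooted*-reroot up ((l , r) ∷ q) zs
  rewrite rooted*-reroot (node (up ++ l ++ r) ∷ []) q zs | rooted*-++ up (l ++ r)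
  = lemma (rooted* up) (rooted* (l ++ r)) (total₁ q) (rooted₁ q) (rooted* zs)
  where lemma : ∀ u s k j z → z * (k + suc (u * s) * 1 * j) ≡ z * (j + k + u * (s * j))
        lemma = solve-∀

allDegs-reroot : ∀ up q zs → allDegs (reroot up q zs) ↭ allDegs (up ++ plug q zs)
allDegs-reroot up [] zs = refl
allDegs-reroot up ((l , r) ∷ q) zs = begin
  allDegs (reroot (node ts ∷ []) q zs)            ↭⟨ allDegs-reroot _ q zs ⟩
  suc (length us) ∷ suc (length ts) ∷ degs* ts ++ degs* us  ↭⟨ swap _ _ (++-comm (degs* ts) _) ⟩
  suc (length ts) ∷ suc (length us) ∷ degs* us ++ degs* ts  ↭⟨ allDegs-↭ (shift-inner (node us) up l r) ⟨
  allDegs (up ++ l ++ node us ∷ r)                ∎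
  where
  open PermutationReasoning
  ts = up ++ l ++ r
  us = plug q zs

weights*-reroot : ∀ up q zs → weights* (reroot up q zs) ↭ weights* (up ++ plug q zs)
weights*-reroot up [] zs = refl
weights*-reroot up ((l , r) ∷ q) zs = begin
  weights* (reroot (node ts ∷ []) q zs)  ↭⟨ weights*-reroot _ q zs ⟩
  weights* ts ++ weights* us             ↭⟨ ++-comm (weights* ts) _ ⟩
  weights* us ++ weights* ts             ↭⟨ weights*-↭ (shift-inner (node us) up l r) ⟨
  weights* (up ++ l ++ node us ∷ r)      ∎
  where
  open PermutationReasoning
  ts = up ++ l ++ r
  us = plug q zs

degree-position : ∀ us {d} → d ∈ degs (node us) →
                  ∃₂ λ q zs → us ≡ plug q zs × d ≡ suc (length zs)
degree-position* : ∀ ts {d} → d ∈ degs* ts →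
                   ∃₂ λ l r → ∃₂ λ q zs → ts ≡ l ++ node (plug q zs) ∷ r × d ≡ suc (length zs)
degree-position us (here e) = [] , us , refl , e
degree-position us (there d∈) with degree-position* us d∈
... | l , r , q , zs , refl , e = (l , r) ∷ q , zs , refl , e
degree-position* (leaf w ∷ ts) d∈ with degree-position* ts d∈
... | l , r , q , zs , refl , e = leaf w ∷ l , r , q , zs , refl , e
degree-position* (node us ∷ ts) d∈ with ∈-++⁻ (degs (node us)) d∈
... | inj₁ d∈us with degree-position us d∈us
...   | q , zs , refl , e = [] , ts , q , zs , refl , e
degree-position* (node us ∷ ts) d∈ | inj₂ d∈ts with degree-position* ts d∈ts
... | l , r , q , zs , refl , e = node us ∷ l , r , q , zs , refl , e

weight-position : ∀ us {b} → b ∈ weights* us → ∃ λ q → ∃₂ λ l r → us ≡ plug q (l ++ leaf b ∷ r)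
weight-position-∷ : ∀ t us {b} → b ∈ weights* us → ∃ λ q → ∃₂ λ l r → t ∷ us ≡ plug q (l ++ leaf b ∷ r)
weight-position (leaf w ∷ us) (here refl) = [] , [] , us , refl
weight-position (leaf w ∷ us) (there b∈) = weight-position-∷ (leaf w) us b∈
weight-position (node ts ∷ us) b∈ with ∈-++⁻ (weights* ts) b∈
... | inj₂ b∈us = weight-position-∷ (node ts) us b∈us
... | inj₁ b∈ts with weight-position ts b∈ts
...   | q , l , r , refl = ([] , us) ∷ q , l , r , refl
weight-position-∷ t us b∈ with weight-position us b∈
... | []             , l , r , refl = [] , t ∷ l , r , refl
... | (l₀ , r₀) ∷ q  , l , r , refl = (t ∷ l₀ , r₀) ∷ q , l , r , refl

degrees-at : ∀ q zs s → allDegs (node (plug q zs) ∷ s) ↭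
                        pathDegs q ++ suc (length s) ∷ suc (length zs) ∷ degs* zs ++ degs* s
degrees-at q zs s = begin
  suc (length s) ∷ degs (node (plug q zs)) ++ degs* s              ↭⟨ prep _ (++⁺ʳ (degs* s) (degs-plug q zs)) ⟩
  suc (length s) ∷ (pathDegs q ++ degs (node zs)) ++ degs* s       ≡⟨ cong (_ ∷_) (++-assoc (pathDegs q) _ _) ⟩
  suc (length s) ∷ pathDegs q ++ degs (node zs) ++ degs* s         ↭⟨ shift _ (pathDegs q) _ ⟨
  pathDegs q ++ suc (length s) ∷ degs (node zs) ++ degs* s         ∎
  where open PermutationReasoning

weights-at : ∀ q zs s → weights* (node (plug q zs) ∷ s) ↭ pathWeights q ++ weights* zs ++ weights* s
weights-at q zs s = begin
  weights* (plug q zs) ++ weights* s             ↭⟨ ++⁺ʳ (weights* s) (weights*-plug q zs) ⟩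
  (pathWeights q ++ weights* zs) ++ weights* s   ≡⟨ ++-assoc (pathWeights q) _ _ ⟩
  pathWeights q ++ weights* zs ++ weights* s     ∎
  where open PermutationReasoning

-- The two sides differ by (α - β)(Y - X), and the premises force `X < Y`.
rearrangement : ∀ {α β X Y} → β < α → 1 ≤ X → α * X ≤ β * Y → α * X + β * Y < β * X + α * Y
rearrangement {α} {β} {X} {Y} β<α 1≤X αX≤βY = bound (m≤n⇒∃[o]m+o≡n β<α) (m≤n⇒∃[o]m+o≡n X<Y)
  where
  X<Y : X < Y
  X<Y = ≰⇒> λ Y≤X → <-irrefl refl (begin-strict
    β * Y  ≤⟨ *-monoʳ-≤ β Y≤X ⟩
    β * X  <⟨ *-monoˡ-< X {{>-nonZero 1≤X}} β<α ⟩
    α * X  ≤⟨ αX≤βY ⟩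
    β * Y  ∎)
    where open ≤-Reasoning
  -- With `α = suc β + p` and `Y = suc X + q` the gain is (1 + p)(1 + q); the leading `suc` takes
  -- the 1 that makes the inequality strict.
  identity : ∀ β X p q → suc ((suc β + p) * X + β * (suc X + q)) + (p + q + p * q) ≡ β * X + (suc β + p) * (suc X + q)
  identity = solve-∀
  bound : (∃ λ p → suc β + p ≡ α) → (∃ λ q → suc X + q ≡ Y) → α * X + β * Y < β * X + α * Y
  bound (p , refl) (q , refl) = ≤-trans (m≤m+n _ _) (≤-reflexive (identity β X p q))

-- Let v be the root and y the vertex at path q.  If the branches exchanged
-- between v and y contribute the factors α and β, then whole is
-- α X + β Y + α β Z + const with X, Y, Z counting the subtrees that contain
-- v only, y only, both; the premise says α (X + β Z) ≤ β (Y + α Z).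
exchange : ∀ q zs s zs′ s′ α β L M →
           rooted* s ≡ α * L → rooted* zs ≡ β * M →
           rooted* s′ ≡ β * L → rooted* zs′ ≡ α * M →
           total* zs + total* s ≡ total* zs′ + total* s′ →
           β < α → 1 ≤ L →
           rooted* (node (plug q zs) ∷ s) ≤ rooted* (reroot (node s ∷ []) q zs) →
           whole (node (plug q zs) ∷ s) < whole (node (plug q zs′) ∷ s′)
exchange q zs s zs′ s′ α β L M es ez es′ ez′ et β<α 1≤L v≤y = begin-strict
  whole (node (plug q zs) ∷ s)                                   ≡⟨ value zs s ⟩
  rest (rooted* s) (rooted* zs) + (total* zs + total* s)    ≡⟨ cong₂ _+_ (cong₂ rest es ez) et ⟩
  rest (α * L) (β * M) + t′                                 ≡⟨ cong (_+ t′) (identity₁ α β L M c j k e) ⟩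
  α * X + β * Y + (α * β * (L * M * j) + (c + e)) + t′           <⟨ +-monoˡ-< t′ (+-monoˡ-< (α * β * (L * M * j) + (c + e)) main) ⟩
  β * X + α * Y + (α * β * (L * M * j) + (c + e)) + t′           ≡⟨ cong (_+ t′) (identity₂ α β L M c j k e) ⟨
  rest (β * L) (α * M) + t′                               ≡⟨ cong (_+ t′) (cong₂ rest es′ ez′) ⟨
  rest (rooted* s′) (rooted* zs′) + t′                    ≡⟨ value zs′ s′ ⟨
  whole (node (plug q zs′) ∷ s′)                                 ∎
  where
  open ≤-Reasoning
  c = rooted₀ q
  j = rooted₁ q
  e = total₀ q
  k = total₁ q
  t′ = total* zs′ + total* s′
  -- In `suc c` the branch towards y is left out or entered without reaching y. In `k + j` a subtree
  -- through y either misses the child of v on the path or contains it but stops before v.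
  X = L * suc c
  Y = M * (k + j)
  rest : ℕ → ℕ → ℕ
  rest ps pz = suc (c + j * pz) * ps + (c + j * pz + (e + k * pz))
  value : ∀ zs s → whole (node (plug q zs) ∷ s) ≡ rest (rooted* s) (rooted* zs) + (total* zs + total* s)
  value zs s rewrite rooted*-plug q zs | total*-plug q zs 
    = lemma (suc (c + j * rooted* zs) * rooted* s) (c + j * rooted* zs) (e + k * rooted* zs) (total* zs) (total* s)
    where lemma : ∀ a b d t u → a + (b + (d + t) + u) ≡ a + (b + d) + (t + u)
          lemma = solve-∀
  identity₁ : ∀ α β L M c j k e → suc (c + j * (β * M)) * (α * L) + (c + j * (β * M) + (e + k * (β * M)))
              ≡ α * (L * suc c) + β * (M * (k + j)) + (α * β * (L * M * j) + (c + e))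
  identity₁ = solve-∀
  identity₂ : ∀ α β L M c j k e → suc (c + j * (α * M)) * (β * L) + (c + j * (α * M) + (e + k * (α * M)))
              ≡ β * (L * suc c) + α * (M * (k + j)) + (α * β * (L * M * j) + (c + e))
  identity₂ = solve-∀
  identity₃ : ∀ α β L M c j → suc (c + j * (β * M)) * (α * L) ≡ α * (L * suc c) + α * β * (L * M * j)
  identity₃ = solve-∀
  identity₄ : ∀ α β L M j k → β * M * (k + suc (α * L) * 1 * j) ≡ β * (M * (k + j)) + α * β * (L * M * j)
  identity₄ = solve-∀
  αX≤βY : α * X ≤ β * Y
  αX≤βY = +-cancelʳ-≤ (α * β * (L * M * j)) _ _ (begin
    α * X + α * β * (L * M * j)                    ≡⟨ identity₃ α β L M c j ⟨
    suc (c + j * (β * M)) * (α * L)                ≡⟨ cong₂ (λ a b → suc (c + j * a) * b) ez es ⟨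
    suc (c + j * rooted* zs) * rooted* s           ≡⟨ cong (λ a → suc a * rooted* s) (rooted*-plug q zs) ⟨
    rooted* (node (plug q zs) ∷ s)                 ≤⟨ v≤y ⟩
    rooted* (reroot (node s ∷ []) q zs)            ≡⟨ rooted*-reroot (node s ∷ []) q zs ⟩
    rooted* zs * (k + suc (rooted* s) * 1 * j)     ≡⟨ cong₂ (λ a b → a * (k + suc b * 1 * j)) ez es ⟩
    β * M * (k + suc (α * L) * 1 * j)              ≡⟨ identity₄ α β L M j k ⟩
    β * Y + α * β * (L * M * j)                    ∎)
  main : α * X + β * Y < β * X + α * Y
  main = rearrangement β<α (*-mono-≤ 1≤L (s≤s z≤n)) αX≤βY

-- The Huffman bound

Π⁺-↭ : ∀ {xs ys} → xs ↭ ys → Π⁺ xs ≡ Π⁺ ys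
Π⁺-↭ p = product-↭ (map⁺ suc p)

Π⁺-++ : ∀ xs ys → Π⁺ (xs ++ ys) ≡ Π⁺ xs * Π⁺ ys
Π⁺-++ xs ys = trans (cong product (map-++ suc xs ys)) (product-++ (map suc xs) (map suc ys))

Π⁺≥1 : ∀ xs → 1 ≤ Π⁺ xs
Π⁺≥1 [] = ≤-refl
Π⁺≥1 (x ∷ xs) = *-mono-≤ {1} {suc x} (s≤s z≤n) (Π⁺≥1 xs)

-- The weights of the remaining leaves form an ascending queue: the d ∸ 1
-- smallest are merged into a new leaf, whose weight is the largest so far.
huffman : List ℕ → List ℕ → ℕ
huffman []           ws = 0
huffman (d ∷ [])     ws = Π⁺ ws + sum ws
huffman (d ∷ d′ ∷ ds) ws =
  sum (take (d ∸ 1) ws) + huffman (d′ ∷ ds) (drop (d ∸ 1) ws ++ Π⁺ (take (d ∸ 1) ws) ∷ [])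

-- `bounded` says that no weight exceeds the leaf created by the next merge, so appending that leaf
-- at the end keeps the queue ascending. `positive` makes moving a leaf change a product strictly.
record Queue (d : ℕ) (ws : List ℕ) : Set where
  constructor queue
  field
    sorted   : AllPairs _≤_ ws
    positive : All (1 ≤_) ws
    bounded  : All (_≤ Π⁺ (take (d ∸ 1) ws)) ws

Π⁺-mono : ∀ xs ys → length xs ≤ length ys → (∀ {x y} → x ∈ xs → y ∈ ys → x ≤ y) → Π⁺ xs ≤ Π⁺ ys
Π⁺-mono [] ys _ _ = Π⁺≥1 ys
Π⁺-mono (x ∷ xs) (y ∷ ys) (s≤s l) h =
  *-mono-≤ (s≤s (h (here refl) (here refl))) (Π⁺-mono xs ys l λ i j → h (there i) (there j))

sorted-++ : ∀ {xs ys} → AllPairs _≤_ (xs ++ ys) → ∀ {x y} → x ∈ xs → y ∈ ys → x ≤ y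
sorted-++ (p ∷ ps) (here refl) j = All.lookup p (∈-++⁺ʳ _ j)
sorted-++ (p ∷ ps) (there i) j = sorted-++ ps i j

-- The new leaf is the largest entry of the new queue. As degrees ascend, the following merge takes
-- at least as many factors, each at least as large as any factor taken now, so its product is at
-- least as large. The length premise rules out that this merge is cut short.
queue-step : ∀ {d d′ ws} → d ≤ d′ → Queue d ws → let xs = take (d ∸ 1) ws; ys = drop (d ∸ 1) ws ++ Π⁺ xs ∷ [] in
             d ∸ 1 ≤ length ys → Queue d′ ys
queue-step {d} {d′} {ws} d≤d′ (queue s p b) len = queue
  (AllPairs.++⁺ (AllPairs.drop⁺ (d ∸ 1) s) ([] ∷ []) (All.map (_∷ []) (All.drop⁺ (d ∸ 1) b)))
  (All.++⁺ (All.drop⁺ (d ∸ 1) p) (Π⁺≥1 xs ∷ []))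
  (All.map (λ le → ≤-trans le top) (All.++⁺ (All.drop⁺ (d ∸ 1) b) (≤-refl ∷ [])))
  where
  xs = take (d ∸ 1) ws
  ys = drop (d ∸ 1) ws ++ Π⁺ xs ∷ []
  zs = take (d′ ∸ 1) ys
  ws≡ : xs ++ drop (d ∸ 1) ws ≡ ws
  ws≡ = take++drop≡id (d ∸ 1) ws
  xs≤ys : ∀ {x y} → x ∈ xs → y ∈ ys → x ≤ y
  xs≤ys x∈ y∈ with ∈-++⁻ (drop (d ∸ 1) ws) y∈
  ... | inj₁ y∈d = sorted-++ (subst (AllPairs _≤_) (sym ws≡) s) x∈ y∈d
  ... | inj₂ (here refl) = All.lookup b (subst (_ ∈_) ws≡ (∈-++⁺ˡ x∈))
  ∈-take : ∀ n {y} {l : List ℕ} → y ∈ take n l → y ∈ l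
  ∈-take n {l = l} i = subst (_ ∈_) (take++drop≡id n l) (∈-++⁺ˡ i)
  len′ : length xs ≤ length zs
  len′ = begin
    length xs                    ≡⟨ length-take (d ∸ 1) ws ⟩
    (d ∸ 1) ⊓ length ws          ≤⟨ m⊓n≤m _ _ ⟩
    d ∸ 1                        ≤⟨ ⊓-glb (∸-monoˡ-≤ 1 d≤d′) len ⟩
    (d′ ∸ 1) ⊓ length ys         ≡⟨ length-take (d′ ∸ 1) ys ⟨
    length zs                    ∎
    where open ≤-Reasoning
  top : Π⁺ xs ≤ Π⁺ zs
  top = Π⁺-mono xs zs len′ λ i j → xs≤ys i (∈-take (d′ ∸ 1) j)

take-length : ∀ {A : Set} (xs ys : List A) → take (length xs) (xs ++ ys) ≡ xs
take-length [] ys = refl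
take-length (x ∷ xs) ys = cong (x ∷_) (take-length xs ys)

drop-length : ∀ {A : Set} (xs ys : List A) → drop (length xs) (xs ++ ys) ≡ ys
drop-length [] ys = refl
drop-length (x ∷ xs) ys = drop-length xs ys

-- Equal weights leave it open which leaves come first, but not as multisets: the two parts sorted
-- separately and concatenated form a sorted permutation of `ws`, which must be `ws` itself.
smallest-prefix : ∀ xs ys {ws} → AllPairs _≤_ ws → xs ++ ys ↭ ws →
                  (∀ {x y} → x ∈ xs → y ∈ ys → x ≤ y) →
                  xs ↭ take (length xs) ws × ys ↭ drop (length xs) ws
smallest-prefix xs ys {ws} s p h = goal (length xs) (↭-length (sort-↭ xs))
  where
  sort-sorted : ∀ l → AllPairs _≤_ (sort l)
  sort-sorted l = Linked⇒AllPairs ≤-trans (sort-↗ l)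
  eq : sort xs ++ sort ys ≡ ws
  eq = Pointwise-≡⇒≡ (↗↭↗⇒≋ ≤-totalOrder
    (AllPairs⇒Linked (AllPairs.++⁺ (sort-sorted xs) (sort-sorted ys)
      (All.tabulate λ i → All.tabulate λ j → h (∈-resp-↭ (sort-↭ xs) i) (∈-resp-↭ (sort-↭ ys) j))))
    (AllPairs⇒Linked s)
    (↭⇒↭ₛ (compose (++⁺ (sort-↭ xs) (sort-↭ ys)) p)))
  goal : ∀ n → length (sort xs) ≡ n → xs ↭ take n ws × ys ↭ drop n ws
  goal n refl rewrite sym eq | take-length (sort xs) (sort ys) | drop-length (sort xs) (sort ys) =
    ↭-sym (sort-↭ xs) , ↭-sym (sort-↭ ys)

-- The total weight of all vertex sets, connected or not: an internal vertex has two choices, a leaf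
-- of weight `w` contributes `1 + w`. The empty set makes the bounds on `total` and `whole` strict.
-- The value depends only on the data that exchanges preserve.
size-bound : List ℕ → List ℕ → ℕ
size-bound ds ws = 2 ^ length ds * Π⁺ ws

size-bound-++ : ∀ ds ds′ ws ws′ → size-bound (ds ++ ds′) (ws ++ ws′) ≡ size-bound ds ws * size-bound ds′ ws′
size-bound-++ ds ds′ ws ws′
  rewrite length-++ ds {ds′} | ^-distribˡ-+-* 2 (length ds) (length ds′) | Π⁺-++ ws ws′
  = lemma (2 ^ length ds) (2 ^ length ds′) (Π⁺ ws) (Π⁺ ws′)
  where lemma : ∀ a b c d → a * b * (c * d) ≡ a * c * (b * d)
        lemma = solve-∀

total<size-bound : ∀ t → total t < size-bound (degs t) (weights t)
rooted<size-bound : ∀ t → rooted t < size-bound (degs t) (weights t)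
total*<size-bound : ∀ ts → total* ts < size-bound (degs* ts) (weights* ts)
rooted*≤size-bound : ∀ ts → rooted* ts ≤ size-bound (degs* ts) (weights* ts)
whole<size-bound : ∀ ts → whole ts < size-bound (allDegs ts) (weights* ts)
total<size-bound (leaf w) = ≤-reflexive (sym (trans (+-identityʳ _) (*-identityʳ _)))
total<size-bound (node ts) = whole<size-bound ts
rooted<size-bound (leaf w) = ≤-reflexive (sym (trans (+-identityʳ _) (*-identityʳ _)))
rooted<size-bound (node ts) = ≤-<-trans (m≤m+n _ _) (whole<size-bound ts)
total*<size-bound [] = ≤-refl
total*<size-bound (t ∷ ts) rewrite size-bound-++ (degs t) (degs* ts) (weights t) (weights* ts) = begin
  suc (total t + total* ts)                ≤⟨ m≤m+n _ _ ⟩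
  suc (total t + total* ts) + total t * total* ts  ≡⟨ lemma (total t) (total* ts) ⟩
  suc (total t) * suc (total* ts)          ≤⟨ *-mono-≤ (total<size-bound t) (total*<size-bound ts) ⟩
  size-bound (degs t) (weights t) * size-bound (degs* ts) (weights* ts) ∎
  where
  open ≤-Reasoning
  lemma : ∀ a b → suc (a + b) + a * b ≡ suc a * suc b
  lemma = solve-∀
rooted*≤size-bound [] = ≤-refl
rooted*≤size-bound (t ∷ ts) rewrite size-bound-++ (degs t) (degs* ts) (weights t) (weights* ts) =
  *-mono-≤ (rooted<size-bound t) (rooted*≤size-bound ts)
whole<size-bound ts = begin
  suc (rooted* ts + total* ts)     ≡⟨ +-suc (rooted* ts) (total* ts) ⟨
  rooted* ts + suc (total* ts)     ≤⟨ +-mono-≤ (rooted*≤size-bound ts) (total*<size-bound ts) ⟩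
  b + b                            ≡⟨ lemma (2 ^ length (degs* ts)) (Π⁺ (weights* ts)) ⟩
  2 * 2 ^ length (degs* ts) * Π⁺ (weights* ts) ∎
  where
  open ≤-Reasoning
  b = size-bound (degs* ts) (weights* ts)
  lemma : ∀ a c → a * c + a * c ≡ 2 * a * c
  lemma = solve-∀

-- Every branch contains a leaf, because an internal vertex of degree at least 2 has a child.
length≤weights : ∀ ts → All (2 ≤_) (degs* ts) → length ts ≤ length (weights* ts)
length≤weights [] _ = z≤n
length≤weights (leaf w ∷ ts) p = s≤s (length≤weights ts p)
length≤weights (node us ∷ ts) (s≤s 1≤us ∷ p)
  rewrite length-++ (weights* us) {weights* ts}
  = +-mono-≤ (≤-trans 1≤us (length≤weights us (All.++⁻ˡ (degs* us) p))) (length≤weights ts (All.++⁻ʳ (degs* us) p))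

-- Trees with given degrees and leaf weights, and the shape of the optimal ones

record HasData (ds ws : List ℕ) (ts : List Tree) : Set where
  constructor hasData
  field
    degrees≡ : allDegs ts ↭ ds
    weights≡ : weights* ts ↭ ws

module _ {ds ws : List ℕ} where

  HasData-↭ : ∀ {ts us} → ts ↭ us → HasData ds ws ts → HasData ds ws us
  HasData-↭ p (hasData e f) = hasData (compose (↭-sym (allDegs-↭ p)) e) (compose (↭-sym (weights*-↭ p)) f)

  HasData-reroot : ∀ s q zs → HasData ds ws (node (plug q zs) ∷ s) → HasData ds ws (reroot (node s ∷ []) q zs)
  HasData-reroot s q zs (hasData e f) = hasData
    (compose (allDegs-reroot (node s ∷ []) q zs)
      (compose (swap _ _ (++-comm (degs* s) _)) e))
    (compose (weights*-reroot (node s ∷ []) q zs) (compose (++-comm (weights* s) _) f))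

  HasData-exchange : ∀ q {zs s zs′ s′} →
    suc (length s) ∷ suc (length zs) ∷ degs* zs ++ degs* s ↭ suc (length s′) ∷ suc (length zs′) ∷ degs* zs′ ++ degs* s′ →
    weights* zs ++ weights* s ↭ weights* zs′ ++ weights* s′ →
    HasData ds ws (node (plug q zs) ∷ s) → HasData ds ws (node (plug q zs′) ∷ s′)
  HasData-exchange q {zs} {s} {zs′} {s′} p r (hasData e f) = hasData
    (begin
      allDegs (node (plug q zs′) ∷ s′)   ↭⟨ degrees-at q zs′ s′ ⟩
      pathDegs q ++ _                    ↭⟨ ++⁺ˡ (pathDegs q) p ⟨
      pathDegs q ++ _                    ↭⟨ degrees-at q zs s ⟨
      allDegs (node (plug q zs) ∷ s)     ↭⟨ e ⟩
      ds                                 ∎)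
    (begin
      weights* (node (plug q zs′) ∷ s′)  ↭⟨ weights-at q zs′ s′ ⟩
      pathWeights q ++ _                 ↭⟨ ++⁺ˡ (pathWeights q) r ⟨
      pathWeights q ++ _                 ↭⟨ weights-at q zs s ⟨
      weights* (node (plug q zs) ∷ s)    ↭⟨ f ⟩
      ws                                 ∎)
    where open PermutationReasoning

-- A maximiser that is moreover rooted at an internal vertex lying in the fewest subtrees. The
-- permutation in `rootMinimal` lets any branch of the root be the one that leads to the vertex
-- compared with it.
record Optimal (ds ws : List ℕ) (ts : List Tree) : Set where
  field
    inClass     : HasData ds ws ts
    best        : ∀ us → HasData ds ws us → whole us ≤ whole ts
    rootMinimal : ∀ q zs s → ts ↭ node (plug q zs) ∷ s → rooted* ts ≤ rooted* (reroot (node s ∷ []) q zs)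

module _ {ds ws ts} (opt : Optimal ds ws ts) where
  open Optimal opt

  -- Otherwise `exchange` would give a tree with the same data and a larger count. Maximality enters
  -- the argument only here.
  exchange-optimal : ∀ q zs s zs′ s′ α β L M → ts ↭ node (plug q zs) ∷ s →
    rooted* s ≡ α * L → rooted* zs ≡ β * M → rooted* s′ ≡ β * L → rooted* zs′ ≡ α * M →
    total* zs + total* s ≡ total* zs′ + total* s′ → 1 ≤ L →
    suc (length s) ∷ suc (length zs) ∷ degs* zs ++ degs* s ↭ suc (length s′) ∷ suc (length zs′) ∷ degs* zs′ ++ degs* s′ →
    weights* zs ++ weights* s ↭ weights* zs′ ++ weights* s′ →
    α ≤ β
  exchange-optimal q zs s zs′ s′ α β L M p es ez es′ ez′ et 1≤L ed ew = ≮⇒≥ λ β<α →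
    <⇒≱ (exchange q zs s zs′ s′ α β L M es ez es′ ez′ et β<α 1≤L
          (subst (_≤ _) (rooted*-↭ p) (rootMinimal q zs s p)))
        (subst (whole (node (plug q zs′) ∷ s′) ≤_) (whole-↭ p) (best _ (HasData-exchange q {zs} {s} {zs′} {s′} ed ew (HasData-↭ p inClass))))

  -- Subtrees through both ends of the edge count equally for both vertices; after cancelling them,
  -- minimality compares the subtrees through exactly one end.
  child-rooted : ∀ us s → ts ↭ node us ∷ s → rooted* s ≤ rooted* us
  child-rooted us s p = +-cancelʳ-≤ (rooted* us * rooted* s) _ _ (begin
    suc (rooted* us) * rooted* s                   ≡⟨ rooted*-↭ p ⟨
    rooted* ts                                     ≤⟨ rootMinimal [] us s p ⟩
    suc (rooted* s) * rooted* us                   ≡⟨ cong (rooted* us +_) (*-comm (rooted* s) (rooted* us)) ⟩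
    rooted* us + rooted* us * rooted* s            ∎)
    where open ≤-Reasoning

  -- Subtrees through the root that avoid one internal child may still enter the other, so
  -- `child-rooted` makes the first child's branch strictly larger than the second's; by symmetry
  -- the converse holds as well.
  no-two-nodes : ∀ us us′ s → ¬ (ts ↭ node us ∷ node us′ ∷ s)
  no-two-nodes us us′ s p = <-asym
    (smaller us us′ (child-rooted us (node us′ ∷ s) p))
    (smaller us′ us (child-rooted us′ (node us ∷ s) (compose p (swap _ _ refl))))
    where
    smaller : ∀ us us′ → rooted* (node us′ ∷ s) ≤ rooted* us → rooted* us′ < rooted* us
    smaller us us′ h = ≤-trans (m≤m*n (suc (rooted* us′)) (rooted* s) {{>-nonZero (rooted*≥1 s)}}) h

  -- The branches exchanged are the two leaves alone, with factors `suc a` at the root and `suc b`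
  -- at the other vertex.
  leaf-weights-minimal : ∀ us s {a b} → ts ↭ node us ∷ map leaf s → a ∈ s → b ∈ weights* us → a ≤ b
  leaf-weights-minimal us s {a} {b} p a∈ b∈ with weight-position us b∈ | ∈-∃++ a∈
  ... | q , l , r , refl | s₁ , s₂ , refl = s≤s⁻¹
    (exchange-optimal q (l ++ leaf b ∷ r) (leaf a ∷ s₀) (leaf a ∷ l ++ r) (leaf b ∷ s₀)
      (suc a) (suc b) (rooted* s₀) (rooted* (l ++ r)) p′
      refl (rooted*-↭ (shift (leaf b) l r)) refl refl
      (trans (cong (_+ (a + total* s₀)) (total*-↭ (shift (leaf b) l r))) (lemma a b (total* (l ++ r)) (total* s₀)))
      (rooted*≥1 s₀)
      (↭-reflexive (cong₂ (λ m e → suc (suc (length s₀)) ∷ suc m ∷ e ++ degs* s₀)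
        (↭-length (shift (leaf b) l r)) (trans (degs*-++ l (leaf b ∷ r)) (sym (degs*-++ l r)))))
      (begin
        weights* (l ++ leaf b ∷ r) ++ a ∷ weights* s₀   ↭⟨ ++⁺ʳ _ (weights*-↭ (shift (leaf b) l r)) ⟩
        b ∷ weights* (l ++ r) ++ a ∷ weights* s₀        ↭⟨ prep b (shift a (weights* (l ++ r)) _) ⟩
        b ∷ a ∷ weights* (l ++ r) ++ weights* s₀        ↭⟨ swap b a refl ⟩
        a ∷ b ∷ weights* (l ++ r) ++ weights* s₀        ↭⟨ prep a (shift b (weights* (l ++ r)) _) ⟨
        a ∷ weights* (l ++ r) ++ b ∷ weights* s₀        ∎))
    where
    open PermutationReasoning
    s₀ = map leaf (s₁ ++ s₂)
    p′ : ts ↭ node (plug q (l ++ leaf b ∷ r)) ∷ leaf a ∷ s₀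
    p′ = compose p (prep _ (map⁺ leaf (shift a s₁ s₂)))
    lemma : ∀ a b x y → b + x + (a + y) ≡ a + x + (b + y)
    lemma = solve-∀

  -- Suppose a vertex below has smaller degree than the root. The surplus leaves `A` of the root are
  -- exchanged against nothing, so the factors are `Π⁺ A` and 1; positive weights give `1 < Π⁺ A`,
  -- against `exchange-optimal`.
  root-degree-minimal : ∀ us s {d} → ts ↭ node us ∷ map leaf s → All (1 ≤_) s →
                        d ∈ degs (node us) → length ts ≤ d
  root-degree-minimal us s {d} p pos d∈ = ≮⇒≥ λ d<ts → not-smaller (subst (d <_) (↭-length p) d<ts)
    where
    not-smaller : ¬ (d < suc (length (map leaf s)))
    not-smaller d< with degree-position us d∈
    ... | q , zs , refl , refl = <⇒≱ 1<Π (exchange-optimal q zs (map leaf s) (map leaf A ++ zs) (map leaf B)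
        (Π⁺ A) 1 (Π⁺ B) (rooted* zs) p
        (trans (rooted*-leaves s) (trans (cong Π⁺ (sym AB)) (Π⁺-++ A B)))
        (sym (*-identityˡ _))
        (trans (rooted*-leaves B) (sym (*-identityˡ _)))
        (trans (rooted*-++ (map leaf A) zs) (cong (_* rooted* zs) (rooted*-leaves A)))
        totals
        (Π⁺≥1 B)
        (↭-trans (↭-reflexive degrees₁) (↭-trans (swap _ _ refl) (↭-reflexive degrees₂)))
        weights₁)
      where
      open PermutationReasoning
      zs<s : length zs < length s
      zs<s = subst (length zs <_) (length-map leaf s) (s≤s⁻¹ d<)
      -- Moving exactly this many leaves swaps the degrees of the two vertices, so the degree
      -- sequence is preserved.
      k = length s ∸ length zs
      A = take k s
      B = drop k s
      AB : A ++ B ≡ s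
      AB = take++drop≡id k s
      |A| : length A ≡ k
      |A| = trans (length-take k s) (m≤n⇒m⊓n≡m (m∸n≤m (length s) (length zs)))
      |B| : length B ≡ length zs
      |B| = trans (length-drop k s) (m∸[m∸n]≡n (<⇒≤ zs<s))
      1<Π : 1 < Π⁺ A
      1<Π = nonempty A (subst (1 ≤_) (sym |A|) (m<n⇒0<n∸m zs<s)) (All.take⁺ k pos)
        where
        nonempty : ∀ l → 1 ≤ length l → All (1 ≤_) l → 1 < Π⁺ l
        nonempty (x ∷ l) _ (1≤x ∷ _) = ≤-trans (s≤s 1≤x) (m≤m*n (suc x) (Π⁺ l) {{>-nonZero (Π⁺≥1 l)}})
      totals : total* zs + total* (map leaf s) ≡ total* (map leaf A ++ zs) + total* (map leaf B)
      totals rewrite total*-++ (map leaf A) zs | total*-leaves s | total*-leaves A | total*-leaves B =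
        trans (cong (total* zs +_) (trans (cong sum (sym AB)) (sum-++ A B))) (lemma (total* zs) (sum A) (sum B))
        where lemma : ∀ z a b → z + (a + b) ≡ a + z + b
              lemma = solve-∀
      degrees₁ : suc (length (map leaf s)) ∷ suc (length zs) ∷ degs* zs ++ degs* (map leaf s)
                 ≡ suc (length s) ∷ suc (length zs) ∷ degs* zs ++ []
      degrees₁ = cong₂ (λ n e → suc n ∷ suc (length zs) ∷ degs* zs ++ e) (length-map leaf s) (degs*-leaves s)
      |A++zs| : length (map leaf A ++ zs) ≡ length s
      |A++zs| = trans (length-++ (map leaf A)) (trans (cong₂ _+_ (trans (length-map leaf A) |A|) refl) (m∸n+n≡m (<⇒≤ zs<s)))
      degs-A++zs : degs* (map leaf A ++ zs) ≡ degs* zs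
      degs-A++zs = trans (degs*-++ (map leaf A) zs) (cong (_++ degs* zs) (degs*-leaves A))
      degrees₂ : suc (length zs) ∷ suc (length s) ∷ degs* zs ++ []
                 ≡ suc (length (map leaf B)) ∷ suc (length (map leaf A ++ zs)) ∷ degs* (map leaf A ++ zs) ++ degs* (map leaf B)
      degrees₂ = cong₂ _∷_ (cong suc (sym (trans (length-map leaf B) |B|)))
        (cong₂ _∷_ (cong suc (sym |A++zs|)) (cong₂ _++_ (sym degs-A++zs) (sym (degs*-leaves B))))
      weights₁ : weights* zs ++ weights* (map leaf s) ↭ weights* (map leaf A ++ zs) ++ weights* (map leaf B)
      weights₁ rewrite weights*-++ (map leaf A) zs | weights*-leaves s | weights*-leaves A | weights*-leaves B = begin
        weights* zs ++ s              ≡⟨ cong (weights* zs ++_) AB ⟨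
        weights* zs ++ A ++ B         ↭⟨ shifts (weights* zs) A ⟩
        A ++ weights* zs ++ B         ≡⟨ ++-assoc A _ _ ⟨
        (A ++ weights* zs) ++ B       ∎

-- The `Π⁺ s` ways to extend the root into its leaves become the weight of the new leaf. Only the
-- single leaves of `s` are lost, which is the summand `sum s`.
whole-contract : ∀ us s → whole (node us ∷ map leaf s) ≡ sum s + whole (leaf (Π⁺ s) ∷ us)
whole-contract us s rewrite rooted*-leaves s | total*-leaves s = lemma (rooted* us) (total* us) (Π⁺ s) (sum s)
  where lemma : ∀ r t p z → suc r * p + (r + t + z) ≡ z + (suc p * r + (p + t))
        lemma = solve-∀

star-huffman : ∀ {d ws ts} → HasData (d ∷ []) ws ts → whole ts ≡ huffman (d ∷ []) ws
star-huffman {d} {ws} {ts} (hasData e f) with split-nodes-leaves ts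
... | us ∷ uss , s , p = contradiction (trans (sym (↭-length e)) (↭-length (allDegs-↭ p))) λ ()
... | [] , s , p = trans (whole-↭ p) (cong₂ _+_ (trans (rooted*-leaves s) (Π⁺-↭ s↭ws)) (trans (total*-leaves s) (sum-↭ s↭ws)))
  where
  s↭ws : s ↭ ws
  s↭ws = compose (↭-reflexive (sym (weights*-leaves s))) (compose (↭-sym (weights*-↭ p)) f)

-- Induction over the merges

HuffmanBound : List ℕ → Set
HuffmanBound [] = ⊥
HuffmanBound ds@(d ∷ _) = ∀ ws ts → Queue d ws → HasData ds ws ts → whole ts ≤ huffman ds ws

optimal-bound : ∀ {d d′ ds ws ts} → AllPairs _≤_ (d ∷ d′ ∷ ds) → All (2 ≤_) (d ∷ d′ ∷ ds) → Queue d ws →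
                HuffmanBound (d′ ∷ ds) → Optimal (d ∷ d′ ∷ ds) ws ts → whole ts ≤ huffman (d ∷ d′ ∷ ds) ws
optimal-bound {d} {d′} {ds} {ws} {ts} (d≤ ∷ sorted) (2≤d ∷ 2≤ds) Q ih opt with split-nodes-leaves ts
... | [] , s , p = contradiction
  (trans (sym (↭-length (HasData.degrees≡ (Optimal.inClass opt))))
    (trans (↭-length (allDegs-↭ p)) (cong (suc ∘ length) (degs*-leaves s)))) λ ()
... | us ∷ us′ ∷ uss , s , p = contradiction p (no-two-nodes opt us us′ _)
... | us ∷ [] , s , p = begin
  whole ts                                  ≡⟨ trans (whole-↭ p) (whole-contract us s) ⟩
  sum s + whole ts′                         ≡⟨ cong (_+ whole ts′) (sum-↭ s↭xs) ⟩
  sum xs + whole ts′                        ≤⟨ +-monoʳ-≤ (sum xs) (ih ws′ ts′ Q′ (hasData degrees′ weights′)) ⟩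
  huffman (d ∷ d′ ∷ ds) ws                  ∎
  where
  open ≤-Reasoning
  open HasData (Optimal.inClass opt)
  ts′ = leaf (Π⁺ s) ∷ us
  xs = take (d ∸ 1) ws
  ys = drop (d ∸ 1) ws
  ws′ = ys ++ Π⁺ xs ∷ []
  degrees : allDegs (node us ∷ map leaf s) ↭ d ∷ d′ ∷ ds
  degrees = compose (allDegs-↭ (↭-sym p)) degrees≡
  root↭ : length ts ∷ degs (node us) ↭ d ∷ d′ ∷ ds
  root↭ = compose (↭-reflexive (cong₂ _∷_ (↭-length p)
    (sym (trans (cong (degs (node us) ++_) (degs*-leaves s)) (++-identityʳ _))))) degrees
  weights↭ : s ++ weights* us ↭ ws
  weights↭ = compose (++-comm s (weights* us))
    (compose (↭-reflexive (cong (weights* us ++_) (sym (weights*-leaves s))))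
      (compose (weights*-↭ (↭-sym p)) weights≡))
  d≤all : All (d ≤_) (length ts ∷ degs (node us))
  d≤all = All-resp-↭ (↭-sym root↭) (≤-refl ∷ d≤)
  positive-s : All (1 ≤_) s
  positive-s = All.++⁻ˡ s (All-resp-↭ (↭-sym weights↭) (Queue.positive Q))
  root≡ : length ts ≡ d
  -- If the smallest degree `d` occurs below the root instead, the root degree is at most `d` by
  -- optimality and at least `d` because all degrees are.
  root≡ with ∈-resp-↭ (↭-sym root↭) (here refl)
  ... | here e = sym e
  ... | there d∈ = ≤-antisym (root-degree-minimal opt us s p positive-s d∈) (All.head d≤all)
  |s| : length s ≡ d ∸ 1
  |s| = cong (_∸ 1) (trans (sym (trans (↭-length p) (cong suc (length-map leaf s)))) root≡)
  split : s ↭ xs × weights* us ↭ ys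
  split = subst (λ n → s ↭ take n ws × weights* us ↭ drop n ws) |s|
    (smallest-prefix s (weights* us) (Queue.sorted Q) weights↭ (leaf-weights-minimal opt us s p))
  s↭xs = proj₁ split
  degrees′ : allDegs ts′ ↭ d′ ∷ ds
  degrees′ = drop-∷ (compose (↭-reflexive (cong (_∷ degs (node us)) (sym root≡))) root↭)
  weights′ : weights* ts′ ↭ ws′
  weights′ = compose (prep _ (proj₂ split))
    (compose (↭-reflexive (cong (_∷ ys) (Π⁺-↭ s↭xs))) (++-comm (Π⁺ xs ∷ []) ys))
  d≤us : d ≤ suc (length us)
  d≤us = All.head (All.tail d≤all)
  -- The contracted tree has at least `d` branches at its root, since every degree is at least `d`,
  -- and each of them contains a leaf; so enough weights remain.
  Q′ : Queue d′ ws′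
  Q′ = queue-step (All.head d≤) Q (begin
    d ∸ 1                   ≤⟨ m∸n≤m d 1 ⟩
    d                       ≤⟨ d≤us ⟩
    length ts′              ≤⟨ length≤weights ts′ (All.tail (All-resp-↭ (↭-sym degrees′) 2≤ds)) ⟩
    length (weights* ts′)   ≡⟨ ↭-length weights′ ⟩
    length ws′              ∎)

-- The search terminates lexicographically: a better tree lowers the gap n to
-- size-bound, a root in fewer subtrees lowers rooted*.
reduce-to-optimal : ∀ {ds ws} h → (∀ ts → Optimal ds ws ts → whole ts ≤ h) → ∀ ts → HasData ds ws ts → whole ts ≤ h
reduce-to-optimal {ds} {ws} h bound ts₀ c₀ =
  search (size-bound ds ws) (suc (rooted* ts₀)) ts₀ c₀ (m≤m+n _ _) ≤-refl
  where
  search : ∀ n k ts → HasData ds ws ts → size-bound ds ws ≤ n + whole ts → rooted* ts < k → whole ts ≤ h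
  search n zero ts c b ()
  -- Each way for `ts` to fail to be optimal gives a call of the search that proves the goal. So if
  -- the goal fails, `ts` is optimal and `bound` proves the goal after all; deciding `_≤_` removes
  -- the double negation, and no maximiser has to be enumerated.
  search n (suc k) ts c b (s≤s r≤k) = decidable-stable (whole ts ≤? h) λ ¬goal → ¬goal (bound ts (record
    { inClass     = c
    ; best        = λ us c′ → ≮⇒≥ λ lt → ¬goal (≤-trans (<⇒≤ lt) (improve n us c′ lt b))
    ; rootMinimal = λ q zs s p → ≮⇒≥ λ lt → ¬goal (subst (_≤ h) (same q zs s p)
        (search n k (reroot (node s ∷ []) q zs) (HasData-reroot s q zs (HasData-↭ p c))
          (subst (λ w → size-bound ds ws ≤ n + w) (sym (same q zs s p)) b) (<-≤-trans lt r≤k))) }))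
    where
    same : ∀ q zs s → ts ↭ node (plug q zs) ∷ s → whole (reroot (node s ∷ []) q zs) ≡ whole ts
    same q zs s p = trans (whole-reroot (node s ∷ []) q zs)
      (trans (edge (rooted* s) (rooted* (plug q zs)) (total* s) (total* (plug q zs))) (sym (whole-↭ p)))
      where
      edge : ∀ a b s t → suc a * b + (a + s + t) ≡ suc b * a + (b + t + s)
      edge = solve-∀
    improve : ∀ n us → HasData ds ws us → whole ts < whole us → size-bound ds ws ≤ n + whole ts → whole us ≤ h
    improve zero us (hasData e f) lt b = contradiction (<-trans lt (whole<size-bound us))
      (≤⇒≯ (≤-trans (≤-reflexive (cong₂ (λ x y → 2 ^ x * y) (↭-length e) (Π⁺-↭ f))) b))
    improve (suc n) us c′ lt b = search n (suc (rooted* us)) us c′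
      (≤-trans b (≤-trans (≤-reflexive (sym (+-suc n (whole ts)))) (+-monoʳ-≤ n lt))) ≤-refl

huffman-bound : ∀ d ds → AllPairs _≤_ (d ∷ ds) → All (2 ≤_) (d ∷ ds) → HuffmanBound (d ∷ ds)
huffman-bound d [] _ _ ws ts _ c = ≤-reflexive (star-huffman c)
huffman-bound d (d′ ∷ ds) s@(_ ∷ s′) 2≤@(_ ∷ 2≤′) ws ts Q = reduce-to-optimal _
  (λ us → optimal-bound s 2≤ Q (huffman-bound d′ ds s′ 2≤′)) ts

-- Listing the subtrees of a graph

module _ {n : ℕ} where

  insert-∈ : ∀ v (U : Subset n) → v ∈ˢ U [ v ]≔ inside
  insert-∈ v U = Vec.[]≔-updates U v

  insert-⊇ : ∀ v (U : Subset n) {x} → x ∈ˢ U → x ∈ˢ U [ v ]≔ inside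
  insert-⊇ v U {x} x∈ with x Fin.≟ v
  ... | yes refl = insert-∈ v U
  ... | no x≢v = Vec.[]≔-minimal U x v x≢v x∈

  insert-∈⁻ : ∀ v (U : Subset n) {x} → x ≢ v → x ∈ˢ U [ v ]≔ inside → x ∈ˢ U
  insert-∈⁻ v U {x} x≢v x∈ = Vec.lookup⇒[]= x U (trans (sym (Vec.lookup∘update′ x≢v U inside)) (Vec.[]=⇒lookup x∈))

  delete-∉ : ∀ v (U : Subset n) → v ∉ˢ U [ v ]≔ outside
  delete-∉ v U v∈ with trans (sym (Vec.lookup∘update v U outside)) (Vec.[]=⇒lookup v∈)
  ... | ()

  delete-∈⁻ : ∀ v (U : Subset n) {x} → x ∈ˢ U [ v ]≔ outside → x ∈ˢ U
  delete-∈⁻ v U {x} x∈ with x Fin.≟ v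
  ... | yes refl = contradiction x∈ (delete-∉ v U)
  ... | no x≢v = Vec.lookup⇒[]= x U (trans (sym (Vec.lookup∘update′ x≢v U outside)) (Vec.[]=⇒lookup x∈))

  delete-∈ : ∀ v (U : Subset n) {x} → x ≢ v → x ∈ˢ U → x ∈ˢ U [ v ]≔ outside
  delete-∈ v U {x} x≢v = Vec.[]≔-minimal U x v x≢v

  insert-delete : ∀ v (U : Subset n) → v ∈ˢ U → (U [ v ]≔ outside) [ v ]≔ inside ≡ U
  insert-delete v U v∈ = begin
    (U [ v ]≔ outside) [ v ]≔ inside   ≡⟨ Vec.[]≔-idempotent U v ⟩
    U [ v ]≔ inside                    ≡⟨ cong (U [ v ]≔_) (Vec.[]=⇒lookup v∈) ⟨
    U [ v ]≔ Vec.lookup U v            ≡⟨ Vec.[]≔-lookup U v ⟩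
    U                                  ∎
    where open ≡-Reasoning

insert-injective : ∀ {n} v (U V : Subset n) → v ∉ˢ U → v ∉ˢ V → U [ v ]≔ inside ≡ V [ v ]≔ inside → U ≡ V
insert-injective v U V v∉U v∉V e = ⊆-antisym
  (λ {x} x∈ → insert-∈⁻ v V (λ { refl → v∉U x∈ }) (subst (x ∈ˢ_) e (insert-⊇ v U x∈)))
  (λ {x} x∈ → insert-∈⁻ v U (λ { refl → v∉V x∈ }) (subst (x ∈ˢ_) (sym e) (insert-⊇ v V x∈)))

-- A pair (v , p) says that v is attached to the earlier vertex p; the head of
-- the list is the vertex attached last.
Order : ℕ → Set
Order n = List (Fin n × Fin n)

module _ {n : ℕ} (r : Fin n) where

  alive : Order n → List (Fin n)
  alive []            = r ∷ []
  alive ((v , _) ∷ o) = v ∷ alive o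

  -- A subtree avoids the last vertex `v`, or is `v` alone, or arises by adding `v` to a subtree
  -- through its neighbour `p`.
  subtrees : Order n → List (Subset n)
  subtrees []            = ⁅ r ⁆ ∷ []
  subtrees ((v , p) ∷ o) = subtrees o ++ ⁅ v ⁆ ∷ map (_[ v ]≔ inside) (filter (p ∈?_) (subtrees o))

  -- The contraction of a weighted star, one leaf at a time: removing `v` costs its weight, and the
  -- factor `suc (w v)` at `p` records the choice of extending a subtree to `v`.
  eliminate : (Fin n → ℕ) → Order n → ℕ
  eliminate w []            = w r
  eliminate w ((v , p) ∷ o) = w v + eliminate (updateAt w p (suc (w v) *_)) o

weight : ∀ {n} → (Fin n → ℕ) → Subset n → ℕ
weight w []           = 1
weight w (true ∷ U)   = w zero * weight (w ∘ suc) U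
weight w (false ∷ U)  = weight (w ∘ suc) U

weight-∅ : ∀ {n} (w : Fin n → ℕ) → weight w ∅ ≡ 1
weight-∅ {zero}  w = refl
weight-∅ {suc n} w = weight-∅ (w ∘ suc)

weight-⁅⁆ : ∀ {n} (w : Fin n → ℕ) v → weight w ⁅ v ⁆ ≡ w v
weight-⁅⁆ w zero = trans (cong (w zero *_) (weight-∅ (w ∘ suc))) (*-identityʳ _)
weight-⁅⁆ w (suc v) = weight-⁅⁆ (w ∘ suc) v

weight-insert : ∀ {n} (w : Fin n → ℕ) v U → v ∉ˢ U → weight w (U [ v ]≔ inside) ≡ w v * weight w U
weight-insert w zero (false ∷ U) v∉ = refl
weight-insert w zero (true ∷ U) v∉ = contradiction here v∉
weight-insert w (suc v) (false ∷ U) v∉ = weight-insert (w ∘ suc) v U (v∉ ∘ there)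
weight-insert w (suc v) (true ∷ U) v∉ =
  trans (cong (w zero *_) (weight-insert (w ∘ suc) v U (v∉ ∘ there))) (lemma (w zero) (w (suc v)) (weight (w ∘ suc) U))
  where lemma : ∀ a b c → a * (b * c) ≡ b * (a * c)
        lemma = solve-∀

weight-updateAt-∉ : ∀ {n} (w : Fin n → ℕ) p f U → p ∉ˢ U → weight (updateAt w p f) U ≡ weight w U
weight-updateAt-∉ w zero f (false ∷ U) p∉ = refl
weight-updateAt-∉ w zero f (true ∷ U) p∉ = contradiction here p∉
weight-updateAt-∉ w (suc p) f (false ∷ U) p∉ = weight-updateAt-∉ (w ∘ suc) p f U (p∉ ∘ there)
weight-updateAt-∉ w (suc p) f (true ∷ U) p∉ = cong (w zero *_) (weight-updateAt-∉ (w ∘ suc) p f U (p∉ ∘ there))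

weight-updateAt-∈ : ∀ {n} (w : Fin n → ℕ) p k U → p ∈ˢ U → weight (updateAt w p (k *_)) U ≡ k * weight w U
weight-updateAt-∈ w zero k (true ∷ U) here = *-assoc k (w zero) _
weight-updateAt-∈ w (suc p) k (false ∷ U) (there p∈) = weight-updateAt-∈ (w ∘ suc) p k U p∈
weight-updateAt-∈ w (suc p) k (true ∷ U) (there p∈) =
  trans (cong (w zero *_) (weight-updateAt-∈ (w ∘ suc) p k U p∈)) (lemma (w zero) k (weight (w ∘ suc) U))
  where lemma : ∀ a b c → a * (b * c) ≡ b * (a * c)
        lemma = solve-∀

weight-1 : ∀ {n} (U : Subset n) → weight (λ _ → 1) U ≡ 1
weight-1 [] = refl
weight-1 (true ∷ U) = trans (+-identityʳ _) (weight-1 U)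
weight-1 (false ∷ U) = weight-1 U

module _ {n : ℕ} (G : Graph n) (r : Fin n) where

  -- `Growing` makes the listed sets distinct subtrees, which bounds their number from below; adding
  -- `Pendant` makes the list exhaustive, which bounds it from above.
  data Growing : Order n → Set where
    root : Growing []
    grow : ∀ {v p o} → v ∉ alive r o → p ∈ alive r o → T (G v p) → Growing o → Growing ((v , p) ∷ o)

  data Pendant : Order n → Set where
    root : Pendant []
    grow : ∀ {v p o} → (∀ {x} → x ∈ alive r o → T (G v x) → x ≡ p) → Pendant o → Pendant ((v , p) ∷ o)

  subtrees-⊆ : ∀ o {U} → U ∈ subtrees r o → ∀ {x} → x ∈ˢ U → x ∈ alive r o
  subtrees-⊆ [] (here refl) x∈ = here (x∈⁅y⁆⇒x≡y r x∈)
  subtrees-⊆ ((v , p) ∷ o) U∈ x∈ with ∈-++⁻ (subtrees r o) U∈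
  ... | inj₁ i = there (subtrees-⊆ o i x∈)
  ... | inj₂ (here refl) = here (x∈⁅y⁆⇒x≡y v x∈)
  ... | inj₂ (there i) with ∈-map∘filter⁻ (_[ v ]≔ inside) (p ∈?_) i
  ...   | V , V∈ , refl , _ with _ Fin.≟ v
  ...     | yes e = here e
  ...     | no x≢v = there (subtrees-⊆ o V∈ (insert-∈⁻ v V x≢v x∈))

  fresh : ∀ {o v} → v ∉ alive r o → All (v ∉ˢ_) (subtrees r o)
  fresh {o} v∉ = All.tabulate λ U∈ v∈ → v∉ (subtrees-⊆ o U∈ v∈)

  -- A set through `p` occurs once without and once with `v`, together `suc (w v)` times its weight;
  -- this is the factor put on the weight of `p`.
  sum-weights-step : ∀ (w : Fin n → ℕ) v p Us → All (v ∉ˢ_) Us →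
    sum (map (weight w) Us) + sum (map (weight w) (map (_[ v ]≔ inside) (filter (p ∈?_) Us)))
    ≡ sum (map (weight (updateAt w p (suc (w v) *_))) Us)
  sum-weights-step w v p [] [] = refl
  sum-weights-step w v p (U ∷ Us) (v∉ ∷ vs∉) with p ∈? U
  ... | yes p∈ rewrite weight-updateAt-∈ w p (suc (w v)) U p∈
                     | weight-insert w v U v∉ | sym (sum-weights-step w v p Us vs∉)
      = lemma (weight w U) (sum (map (weight w) Us)) (w v * weight w U) _
        where lemma : ∀ a b c d → a + b + (c + d) ≡ a + c + (b + d)
              lemma = solve-∀
  ... | no p∉ rewrite weight-updateAt-∉ w p (suc (w v) *_) U p∉
                    | sym (sum-weights-step w v p Us vs∉)
      = +-assoc (weight w U) _ _

  sum-weights : ∀ {o} → Growing o → ∀ w → sum (map (weight w) (subtrees r o)) ≡ eliminate r w o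
  sum-weights root w = trans (+-identityʳ _) (weight-⁅⁆ w r)
  sum-weights (grow {v} {p} {o} v∉ p∈ _ g) w = begin
    sum (map (weight w) (L ++ ⁅ v ⁆ ∷ M))
      ≡⟨ cong sum (map-++ (weight w) L (⁅ v ⁆ ∷ M)) ⟩
    sum (map (weight w) L ++ map (weight w) (⁅ v ⁆ ∷ M))
      ≡⟨ sum-++ (map (weight w) L) _ ⟩
    sum (map (weight w) L) + (weight w ⁅ v ⁆ + sum (map (weight w) M))
      ≡⟨ cong (λ a → sum (map (weight w) L) + (a + sum (map (weight w) M))) (weight-⁅⁆ w v) ⟩
    sum (map (weight w) L) + (w v + sum (map (weight w) M))
      ≡⟨ lemma (sum (map (weight w) L)) (w v) (sum (map (weight w) M)) ⟩
    w v + (sum (map (weight w) L) + sum (map (weight w) M))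
      ≡⟨ cong (w v +_) (sum-weights-step w v p L (fresh v∉)) ⟩
    w v + sum (map (weight (updateAt w p (suc (w v) *_))) L)
      ≡⟨ cong (w v +_) (sum-weights g _) ⟩
    w v + eliminate r (updateAt w p (suc (w v) *_)) o ∎
    where
    open ≡-Reasoning
    L = subtrees r o
    M = map (_[ v ]≔ inside) (filter (p ∈?_) L)
    lemma : ∀ a b c → a + (b + c) ≡ b + (a + c)
    lemma = solve-∀

  length-subtrees : ∀ {o} → Growing o → length (subtrees r o) ≡ eliminate r (λ _ → 1) o
  length-subtrees {o} g = trans (sum-ones (subtrees r o)) (sum-weights g _)
    where
    sum-ones : ∀ Us → length Us ≡ sum (map (weight {n} (λ _ → 1)) Us)
    sum-ones [] = refl
    sum-ones (U ∷ Us) rewrite weight-1 U = cong suc (sum-ones Us)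

  unique-subtrees : ∀ {o} → Growing o → Unique (subtrees r o)
  unique-subtrees root = [] ∷ []
  unique-subtrees (grow {v} {p} {o} v∉ p∈ _ g) = Unique.++⁺ (unique-subtrees g)
    (All.tabulate single ∷ insert-unique (Unique.filter⁺ (p ∈?_) (unique-subtrees g)) (All.filter⁺ (p ∈?_) (fresh v∉)))
    disjoint
    where
    L = subtrees r o
    v∉L : ∀ {U} → U ∈ L → v ∉ˢ U
    v∉L = All.lookup (fresh v∉)
    insert-unique : ∀ {Us} → Unique Us → All (v ∉ˢ_) Us → Unique (map (_[ v ]≔ inside) Us)
    insert-unique [] [] = []
    insert-unique (U∉ ∷ u) (v∉U ∷ v∉Us) =
      All.map⁺ (All.map (λ { (U≢V , v∉V) e → U≢V (insert-injective v _ _ v∉U v∉V e) }) (All.zip (U∉ , v∉Us)))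
      ∷ insert-unique u v∉Us
    single : ∀ {V} → V ∈ map (_[ v ]≔ inside) (filter (p ∈?_) L) → ⁅ v ⁆ ≢ V
    single V∈ refl with ∈-map∘filter⁻ (_[ v ]≔ inside) (p ∈?_) {xs = L} V∈
    ... | U , U∈ , e , p∈U = v∉L U∈ (subst (_∈ˢ U)
      (x∈⁅y⁆⇒x≡y v (subst (p ∈ˢ_) (sym e) (insert-⊇ v U p∈U))) p∈U)
    disjoint : ∀ {V} → ¬ (V ∈ L × V ∈ ⁅ v ⁆ ∷ map (_[ v ]≔ inside) (filter (p ∈?_) L))
    disjoint (V∈ , here refl) = v∉L V∈ (x∈⁅x⁆ v)
    disjoint (V∈ , there i) with ∈-map∘filter⁻ (_[ v ]≔ inside) (p ∈?_) {xs = L} i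
    ... | U , U∈ , refl , _ = v∉L V∈ (insert-∈ v U)

module _ {n : ℕ} (G : Graph n) where

  -- `WalkIn` for an arbitrary predicate, so that the same connectivity arguments serve subsets and
  -- lists of remaining vertices.
  data Walk (Q : Fin n → Set) : Fin n → Fin n → Set where
    here : ∀ {u} → Q u → Walk Q u u
    step : ∀ {u w v} → Q u → T (G u w) → Walk Q w v → Walk Q u v

  walk-head : ∀ {Q u v} → Walk Q u v → Q u
  walk-head (here q) = q
  walk-head (step q _ _) = q

  toWalk : ∀ {U u v} → WalkIn G U u v → Walk (_∈ˢ U) u v
  toWalk (here q) = here q
  toWalk (step q e w) = step q e (toWalk w)

  fromWalk : ∀ {U u v} → Walk (_∈ˢ U) u v → WalkIn G U u v
  fromWalk (here q) = here q
  fromWalk (step q e w) = step q e (fromWalk w)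

  walk-map : ∀ {Q Q′ u v} → (∀ {x} → Q x → Q′ x) → Walk Q u v → Walk Q′ u v
  walk-map f (here q) = here (f q)
  walk-map f (step q e w) = step (f q) e (walk-map f w)

  walk-++ : ∀ {Q u v x} → Walk Q u v → Walk Q v x → Walk Q u x
  walk-++ (here q) w′ = w′
  walk-++ (step q e w) w′ = step q e (walk-++ w w′)

  Connected : (Fin n → Set) → Set
  Connected Q = ∀ u v → Q u → Q v → Walk Q u v

  module _ (loopless : ∀ u → G u u ≡ false) (G-sym : ∀ u v → G u v ≡ G v u) where

    edge-sym : ∀ {u v} → T (G u v) → T (G v u)
    edge-sym {u} {v} = subst T (G-sym u v)

    walk-sym : ∀ {Q u v} → Walk Q u v → Walk Q v u
    walk-sym (here q) = here q
    walk-sym (step q e w) = walk-++ (walk-sym w) (step (walk-head w) (edge-sym e) (here q))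

    -- Replacing v by its only neighbour p turns each step through v into a
    -- repetition of p.
    module _ {Q Q′ : Fin n → Set} {v p} (Q⊆Q′ : ∀ {x} → Q x → x ≢ v → Q′ x) (Q′p : Q′ p)
             (pendant : ∀ {x} → Q x → T (G v x) → x ≡ p) where

      retract : Fin n → Fin n
      retract x with x Fin.≟ v
      ... | yes _ = p
      ... | no _ = x

      retract-≢ : ∀ {x} → x ≢ v → retract x ≡ x
      retract-≢ {x} x≢v with x Fin.≟ v
      ... | yes e = contradiction e x≢v
      ... | no _ = refl

      retract-walk : ∀ {a b} → Walk Q a b → Walk Q′ (retract a) (retract b)
      retract-walk (here {u} q) with u Fin.≟ v
      ... | yes _ = here Q′p
      ... | no u≢v = here (Q⊆Q′ q u≢v)
      retract-walk (step {u} {w} q e k) with u Fin.≟ v | w Fin.≟ v | retract-walk k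
      ... | yes _    | yes _    | k′ = k′
      ... | yes refl | no _     | k′ = subst (λ x → Walk Q′ x _) (pendant (walk-head k) e) k′
      ... | no _     | yes refl | k′ = subst (λ x → Walk Q′ x _) (sym (pendant q (edge-sym e))) k′
      ... | no u≢v   | no _     | k′ = step (Q⊆Q′ q u≢v) e k′

      remove-pendant : (∀ {x} → Q′ x → Q x × x ≢ v) → Connected Q → Connected Q′
      remove-pendant Q′⊆Q conn a b Q′a Q′b with Q′⊆Q Q′a | Q′⊆Q Q′b
      ... | Qa , a≢v | Qb , b≢v = subst₂ (Walk Q′) (retract-≢ a≢v) (retract-≢ b≢v) (retract-walk (conn a b Qa Qb))

    add-vertex : ∀ {Q v p} → Connected Q → Q p → T (G v p) → Connected (λ x → x ≡ v ⊎ Q x)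
    add-vertex {Q} {v} {p} conn Qp e = λ a b a∈ b∈ → walk-++ (to-p a∈) (walk-sym (to-p b∈))
      where
      to-p : ∀ {a} → a ≡ v ⊎ Q a → Walk (λ x → x ≡ v ⊎ Q x) a p
      to-p (inj₁ refl) = step (inj₁ refl) e (here (inj₂ Qp))
      to-p {a} (inj₂ Qa) = walk-map inj₂ (conn a p Qa Qp)

    module _ (r : Fin n) where

      singleton-connected : ∀ x → ConnectedIn G ⁅ x ⁆
      singleton-connected x a b a∈ b∈ with x∈⁅y⁆⇒x≡y x a∈ | x∈⁅y⁆⇒x≡y x b∈
      ... | refl | refl = here a∈

      subtrees-sound : ∀ {o U} → Growing G r o → U ∈ subtrees r o → Nonempty U × ConnectedIn G U
      subtrees-sound root (here refl) = (r , x∈⁅x⁆ r) , singleton-connected r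
      subtrees-sound (grow {v} {p} {o} v∉ p∈ e g) U∈ with ∈-++⁻ (subtrees r o) U∈
      ... | inj₁ i = subtrees-sound g i
      ... | inj₂ (here refl) = (v , x∈⁅x⁆ v) , singleton-connected v
      ... | inj₂ (there i) with ∈-map∘filter⁻ (_[ v ]≔ inside) (p ∈?_) {xs = subtrees r o} i
      ...   | V , V∈ , refl , p∈V = (v , insert-∈ v V) , λ a b a∈ b∈ → fromWalk (walk-map join
                (add-vertex (λ x y x∈ y∈ → toWalk (proj₂ (subtrees-sound g V∈) x y x∈ y∈)) p∈V e a b (divide a∈) (divide b∈)))
        where
        join : ∀ {x} → x ≡ v ⊎ x ∈ˢ V → x ∈ˢ V [ v ]≔ inside
        join (inj₁ refl) = insert-∈ v V
        join (inj₂ x∈) = insert-⊇ v V x∈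
        divide : ∀ {x} → x ∈ˢ V [ v ]≔ inside → x ≡ v ⊎ x ∈ˢ V
        divide {x} x∈ with x Fin.≟ v
        ... | yes x≡v = inj₁ x≡v
        ... | no x≢v = inj₂ (insert-∈⁻ v V x≢v x∈)

      -- A connected set with `v` and a further vertex contains `p`, the only way out of `v`;
      -- deleting the pendant `v` keeps it connected, so the smaller set is listed by induction.
      subtrees-complete : ∀ {o} → Growing G r o → Pendant G r o → ∀ U → (∀ {x} → x ∈ˢ U → x ∈ alive r o) →
                          Nonempty U → ConnectedIn G U → U ∈ subtrees r o
      subtrees-complete root root U U⊆ (x , x∈) _ = here (⊆-antisym
        (λ y∈ → subst (_∈ˢ ⁅ r ⁆) (sym (is-r (U⊆ y∈))) (x∈⁅x⁆ r))
        (λ y∈ → subst (_∈ˢ U) (trans (is-r (U⊆ x∈)) (sym (x∈⁅y⁆⇒x≡y r y∈))) x∈))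
        where
        is-r : ∀ {y} → y ∈ r ∷ [] → y ≡ r
        is-r (here e) = e
      subtrees-complete (grow {v} {p} {o} v∉ p∈ e g) (grow pendant h) U U⊆ ne conn with v ∈? U
      ... | no v∉U = ∈-++⁺ˡ (subtrees-complete g h U (λ x∈ → older x∈ λ { refl → v∉U x∈ }) ne conn)
        where
        older : ∀ {x} → x ∈ˢ U → x ≢ v → x ∈ alive r o
        older x∈ x≢v with U⊆ x∈
        ... | here x≡v = contradiction x≡v x≢v
        ... | there i = i
      ... | yes v∈U with Fin.any? (λ x → x ∈? U ×-dec ¬? (x Fin.≟ v))
      ...   | no none = ∈-++⁺ʳ (subtrees r o) (here (⊆-antisym
                (λ {y} y∈ → subst (_∈ˢ ⁅ v ⁆) (sym (only-v y y∈)) (x∈⁅x⁆ v))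
                (λ y∈ → subst (_∈ˢ U) (sym (x∈⁅y⁆⇒x≡y v y∈)) v∈U)))
        where
        only-v : ∀ y → y ∈ˢ U → y ≡ v
        only-v y y∈ = decidable-stable (y Fin.≟ v) λ y≢v → none (y , y∈ , y≢v)
      ...   | yes (x , x∈ , x≢v) = ∈-++⁺ʳ (subtrees r o) (there (∈-map∘filter⁺ (_[ v ]≔ inside) (p ∈?_)
                (V , subtrees-complete g h V V⊆ (p , p∈V) V-connected , sym (insert-delete v U v∈U) , p∈V)))
        where
        V = U [ v ]≔ outside
        older : ∀ {x} → x ∈ˢ U → x ≢ v → x ∈ alive r o
        older x∈ x≢v with U⊆ x∈
        ... | here x≡v = contradiction x≡v x≢v
        ... | there i = i
        pendant-U : ∀ {x} → x ∈ˢ U → T (G v x) → x ≡ p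
        pendant-U {x} x∈ e′ with U⊆ x∈
        ... | there i = pendant i e′
        ... | here refl = ⊥-elim (subst T (loopless v) e′)
        first-step : ∀ {y} → WalkIn G U v y → y ≢ v → p ∈ˢ U
        first-step (here _) y≢v = contradiction refl y≢v
        first-step (step _ e′ (here i)) _ = subst (_∈ˢ U) (pendant-U i e′) i
        first-step (step _ e′ (step i _ _)) _ = subst (_∈ˢ U) (pendant-U i e′) i
        p∈V : p ∈ˢ V
        p∈V = delete-∈ v U (λ { refl → v∉ p∈ }) (first-step (conn v x v∈U x∈) x≢v)
        V⊆ : ∀ {y} → y ∈ˢ V → y ∈ alive r o
        V⊆ {y} y∈ = older (delete-∈⁻ v U y∈) λ { refl → delete-∉ v U y∈ }
        V-connected : ConnectedIn G V
        V-connected a b a∈ b∈ = fromWalk (remove-pendant {Q = _∈ˢ U} {Q′ = _∈ˢ V}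
          (λ y∈ y≢v → delete-∈ v U y≢v y∈) p∈V pendant-U (λ {y} y∈ → delete-∈⁻ v U y∈ , λ { refl → delete-∉ v U y∈ })
          (λ a b i j → toWalk (conn a b i j)) a b a∈ b∈)

-- Comparing the number of subtrees with the length of the list

module _ {n : ℕ} (G : Graph n) where

  vertices-injective : ∀ {s t : Subtree G} → Subtree.vertices s ≡ Subtree.vertices t → s ≡ t
  vertices-injective refl = refl

  count≤length : ∀ {a} (L : List (Subset n)) → (∀ U → Nonempty U → ConnectedIn G U → U ∈ L) →
                 Subtree G ↔ Fin a → a ≤ length L
  count≤length {a} L complete iso = Fin.injective⇒≤ {f = position} position-injective
    where
    open Inverse iso
    listed : ∀ (s : Subtree G) → Subtree.vertices s ∈ L
    -- The proofs inside a `Subtree` are irrelevant, so the membership derived from them is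
    -- recovered by deciding it.
    listed (subtree U ne conn) = recompute (member? (Vec.≡-dec Bool._≟_) U L) (complete U ne conn)
    position : Fin a → Fin (length L)
    position i = index (listed (from i))
    position-injective : ∀ {i j} → position i ≡ position j → i ≡ j
    position-injective {i} {j} e = begin
      i            ≡⟨ strictlyInverseˡ i ⟨
      to (from i)  ≡⟨ cong to (vertices-injective (trans (lookup-index (listed (from i)))
                        (trans (cong (lookup L) e) (sym (lookup-index (listed (from j))))))) ⟩
      to (from j)  ≡⟨ strictlyInverseˡ j ⟩
      j            ∎
      where open ≡-Reasoning

  length≤count : ∀ {b} (L : List (Subset n)) → Unique L → (∀ {U} → U ∈ L → Nonempty U × ConnectedIn G U) →
                 Subtree G ↔ Fin b → length L ≤ b
  length≤count {b} L unique sound iso = Fin.injective⇒≤ {f = λ i → to (member i)} λ e →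
      lookup-injective unique (cong Subtree.vertices (injective e))
    where
    open Inverse iso
    injective : ∀ {s t} → to s ≡ to t → s ≡ t
    injective {s} {t} e = trans (sym (strictlyInverseʳ s)) (trans (cong from e) (strictlyInverseʳ t))
    member : Fin (length L) → Subtree G
    member i = subtree (lookup L i) (proj₁ (sound (∈-lookup i))) (proj₂ (sound (∈-lookup i)))
    lookup-injective : ∀ {L : List (Subset n)} → Unique L → ∀ {i j} → lookup L i ≡ lookup L j → i ≡ j
    lookup-injective (_ ∷ u) {zero} {zero} e = refl
    lookup-injective (x∉ ∷ u) {zero} {suc j} e = contradiction e (All.lookup x∉ (∈-lookup j))
    lookup-injective (x∉ ∷ u) {suc i} {zero} e = contradiction (sym e) (All.lookup x∉ (∈-lookup i))
    lookup-injective (_ ∷ u) {suc i} {suc j} e = cong suc (lookup-injective u e)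

-- Pruning a tree graph to a tree with weighted leaves

indicator : Bool → ℕ
indicator true = 1
indicator false = 0

module _ {A : Set} where

  count : (A → Bool) → List A → ℕ
  count f xs = length (filterᵇ f xs)

  count-∷ : ∀ f x xs → count f (x ∷ xs) ≡ indicator (f x) + count f xs
  count-∷ f x xs with f x
  ... | true = refl
  ... | false = refl

  count-sum : ∀ f xs → count f xs ≡ sum (map (indicator ∘ f) xs)
  count-sum f [] = refl
  count-sum f (x ∷ xs) = trans (count-∷ f x xs) (cong (indicator (f x) +_) (count-sum f xs))

  count-cong : ∀ {f g} xs → (∀ x → f x ≡ g x) → count f xs ≡ count g xs
  count-cong {f} {g} [] e = refl
  count-cong {f} {g} (x ∷ xs) e rewrite count-∷ f x xs | count-∷ g x xs | e x | count-cong {f} {g} xs e = refl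

  count-↭ : ∀ f {xs ys} → xs ↭ ys → count f xs ≡ count f ys
  count-↭ f {xs} {ys} p = trans (count-sum f xs) (trans (sum-↭ (map⁺ (indicator ∘ f) p)) (sym (count-sum f ys)))

  sum-+ : ∀ (f g : A → ℕ) xs → sum (map (λ x → f x + g x) xs) ≡ sum (map f xs) + sum (map g xs)
  sum-+ f g [] = refl
  sum-+ f g (x ∷ xs) rewrite sum-+ f g xs = lemma (f x) (g x) (sum (map f xs)) (sum (map g xs))
    where lemma : ∀ a b c d → a + b + (c + d) ≡ a + c + (b + d)
          lemma = solve-∀

  sum-cong : ∀ {f g : A → ℕ} xs → (∀ x → f x ≡ g x) → sum (map f xs) ≡ sum (map g xs)
  sum-cong xs e = cong sum (map-cong e xs)

double-count : ∀ {A B : Set} (f : A → B → Bool) xs ys →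
  sum (map (λ x → count (f x) ys) xs) ≡ sum (map (λ y → count (λ x → f x y) xs) ys)
double-count f [] ys = sym (zeros ys)
  where zeros : ∀ {B : Set} (ys : List B) → sum (map (λ _ → 0) ys) ≡ 0
        zeros [] = refl
        zeros (y ∷ ys) = zeros ys
double-count f (x ∷ xs) ys = begin
  count (f x) ys + sum (map (λ x → count (f x) ys) xs)
    ≡⟨ cong₂ _+_ (count-sum (f x) ys) (double-count f xs ys) ⟩
  sum (map (indicator ∘ f x) ys) + sum (map (λ y → count (λ x → f x y) xs) ys)
    ≡⟨ sum-+ (indicator ∘ f x) (λ y → count (λ x → f x y) xs) ys ⟨
  sum (map (λ y → indicator (f x y) + count (λ x → f x y) xs) ys)
    ≡⟨ sum-cong ys (λ y → count-∷ (λ x → f x y) x xs) ⟨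
  sum (map (λ y → count (λ x → f x y) (x ∷ xs)) ys) ∎
  where open ≡-Reasoning

module _ {n : ℕ} (G : Graph n) (loopless : ∀ u → G u u ≡ false) (G-sym : ∀ u v → G u v ≡ G v u) where

  handshake : sum (map (deg G) (allFin n)) ≡ numEdges G + numEdges G
  handshake = begin
    sum (map (deg G) (allFin n))
      ≡⟨ sum-cong (allFin n) (λ i → trans (count-sum (G i) (allFin n)) (trans (sum-cong (allFin n) (split i))
           (trans (sum-+ _ _ (allFin n)) (sym (cong₂ _+_ (count-sum (up i) (allFin n)) (count-sum (λ j → up j i) (allFin n))))))) ⟩
    sum (map (λ i → count (up i) (allFin n) + count (λ j → up j i) (allFin n)) (allFin n))
      ≡⟨ sum-+ _ _ (allFin n) ⟩
    numEdges G + sum (map (λ i → count (λ j → up j i) (allFin n)) (allFin n))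
      ≡⟨ cong (numEdges G +_) (double-count up (allFin n) (allFin n)) ⟨
    numEdges G + numEdges G ∎
    where
    open ≡-Reasoning
    up : Fin n → Fin n → Bool
    up i j = (Fin.toℕ i <ᵇ Fin.toℕ j) ∧ G i j
    split : ∀ i j → indicator (G i j) ≡ indicator (up i j) + indicator (up j i)
    split i j with Fin.toℕ i <ᵇ Fin.toℕ j in e₁ | Fin.toℕ j <ᵇ Fin.toℕ i in e₂
    ... | true  | false = sym (+-identityʳ _)
    ... | false | true  = cong indicator (G-sym i j)
    ... | true  | true  = contradiction (<ᵇ⇒< (Fin.toℕ i) _ (subst T (sym e₁) _)) (<-asym (<ᵇ⇒< (Fin.toℕ j) _ (subst T (sym e₂) _)))
    ... | false | false = cong indicator (trans (cong (G i) (sym i≡j)) (loopless i))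
      where
      i≡j : i ≡ j
      i≡j = Fin.toℕ-injective (≤-antisym (≮⇒≥ λ lt → subst T e₂ (<⇒<ᵇ lt)) (≮⇒≥ λ lt → subst T e₁ (<⇒<ᵇ lt)))

sum-lower : ∀ {A : Set} (f : A → ℕ) k xs → (∀ {x} → x ∈ xs → k ≤ f x) → k * length xs ≤ sum (map f xs)
sum-lower f k [] h = ≤-reflexive (*-zeroʳ k)
sum-lower f k (x ∷ xs) h = ≤-trans (≤-reflexive (*-suc k (length xs)))
  (+-mono-≤ (h (here refl)) (sum-lower f k xs (h ∘ there)))

count≥1 : ∀ {A : Set} (f : A → Bool) {x xs} → x ∈ xs → T (f x) → 1 ≤ count f xs
count≥1 f x∈ fx = nonempty (∈-filter⁺ (T? ∘ f) x∈ fx)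
  where
  nonempty : ∀ {A : Set} {x : A} {xs} → x ∈ xs → 1 ≤ length xs
  nonempty (here _) = s≤s z≤n
  nonempty (there _) = s≤s z≤n

count≡1 : ∀ {A : Set} (f : A → Bool) xs → count f xs ≡ 1 →
          ∃ λ p → p ∈ xs × T (f p) × (∀ {x} → x ∈ xs → T (f x) → x ≡ p)
count≡1 f xs e with filterᵇ f xs in eq
... | p ∷ [] = p , proj₁ p∈ , proj₂ p∈ , λ x∈ fx → only (subst (_ ∈_) eq (∈-filter⁺ (T? ∘ f) x∈ fx))
  where
  p∈ = ∈-filter⁻ (T? ∘ f) (subst (p ∈_) (sym eq) (here refl))
  only : ∀ {x} → x ∈ p ∷ [] → x ≡ p
  only (here e) = e

concatMap-↭ : ∀ {A B : Set} (f : A → List B) {xs ys} → xs ↭ ys → concatMap f xs ↭ concatMap f ys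
concatMap-↭ f refl = refl
concatMap-↭ f (prep x p) = ++⁺ˡ (f x) (concatMap-↭ f p)
concatMap-↭ f (swap x y p) = concat-swap (f x) (f y) (concatMap-↭ f p)
concatMap-↭ f (compose p q) = compose (concatMap-↭ f p) (concatMap-↭ f q)

module _ {n : ℕ} {A : Set} (f : Fin n → List A) where

  concatMap-updateAt-∉ : ∀ p g {ys} → p ∉ ys → concatMap (updateAt f p g) ys ≡ concatMap f ys
  concatMap-updateAt-∉ p g {[]} p∉ = refl
  concatMap-updateAt-∉ p g {y ∷ ys} p∉ = cong₂ _++_
    (updateAt-minimal y p f λ { refl → p∉ (here refl) }) (concatMap-updateAt-∉ p g (p∉ ∘ there))

  concatMap-updateAt : ∀ p t {ys} → p ∈ ys → Unique ys → concatMap (updateAt f p (t ∷_)) ys ↭ t ∷ concatMap f ys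
  concatMap-updateAt p t (here refl) (p∉ ∷ u) = ↭-reflexive (cong₂ _++_
    (updateAt-updates p f) (concatMap-updateAt-∉ p (t ∷_) λ p∈ → All.lookup p∉ p∈ refl))
  concatMap-updateAt p t {y ∷ ys} (there p∈) (y∉ ∷ u) = begin
    updateAt f p (t ∷_) y ++ _     ≡⟨ cong (_++ _) (updateAt-minimal y p f λ { refl → All.lookup y∉ p∈ refl }) ⟩
    f y ++ _                       ↭⟨ ++⁺ˡ (f y) (concatMap-updateAt p t p∈ u) ⟩
    f y ++ t ∷ concatMap f ys      ↭⟨ shift t (f y) _ ⟩
    t ∷ f y ++ concatMap f ys      ∎
    where open PermutationReasoning

Unique-↭ : ∀ {A : Set} {xs ys : List A} → xs ↭ ys → Unique xs → Unique ys
Unique-↭ p u = Unique-resp-↭ (setoid _) (↭⇒↭ₛ p) u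

eliminate-cong : ∀ {n} (r : Fin n) o {w w′ : Fin n → ℕ} → (∀ x → w x ≡ w′ x) → eliminate r w o ≡ eliminate r w′ o
eliminate-cong r [] e = e r
eliminate-cong r ((v , p) ∷ o) {w} {w′} e = cong₂ _+_ (e v) (eliminate-cong r o pointwise)
  where
  pointwise : ∀ x → updateAt w p (suc (w v) *_) x ≡ updateAt w′ p (suc (w′ v) *_) x
  pointwise x with x Fin.≟ p
  ... | yes refl = trans (updateAt-updates p w) (trans (cong₂ (λ a b → suc a * b) (e v) (e p)) (sym (updateAt-updates p w′)))
  ... | no x≢p = trans (updateAt-minimal x p w x≢p) (trans (e x) (sym (updateAt-minimal x p w′ x≢p)))

-- A vertex without branches must become a leaf of weight 1: `node []` has the same counts but would
-- enter the degree sequence as an internal vertex of degree 1.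
bud : List Tree → Tree
bud []          = leaf 1
bud ts@(_ ∷ _)  = node ts

rooted-bud : ∀ ts → rooted (bud ts) ≡ rooted* ts
rooted-bud [] = refl
rooted-bud (_ ∷ _) = refl

total-bud : ∀ ts → total (bud ts) ≡ whole ts
total-bud [] = refl
total-bud (_ ∷ _) = refl

degs-bud : ∀ ts → degs (bud ts) ≡ filter (2 ≤?_) (suc (length ts) ∷ []) ++ degs* ts
degs-bud [] = refl
degs-bud (_ ∷ _) = refl

weights-bud : ∀ ts → All (_≡ 1) (weights* ts) → All (_≡ 1) (weights (bud ts))
weights-bud [] _ = refl ∷ []
weights-bud (_ ∷ _) h = h

module _ {n : ℕ} (G : Graph n) (loopless : ∀ u → G u u ≡ false) (G-sym : ∀ u v → G u v ≡ G v u) (r : Fin n) where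

  degIn : List (Fin n) → Fin n → ℕ
  degIn xs u = count (G u) xs

  -- `degreeSum` is the edge count in handshake form, which is easy to update when a pendant vertex
  -- goes. The root `r` stays outside `xs` because it is never removed.
  record TreeOn (xs : List (Fin n)) : Set where
    field
      unique    : Unique (r ∷ xs)
      connected : Connected G (_∈ r ∷ xs)
      degreeSum : sum (map (degIn (r ∷ xs)) (r ∷ xs)) ≡ 2 * length xs

  neighbour : ∀ {Q : Fin n → Set} {u v} → Walk G Q u v → u ≢ v → ∃ λ w → Q w × T (G u w)
  neighbour (here _) u≢v = contradiction refl u≢v
  neighbour (step _ e k) _ = _ , walk-head G k , e

  -- Connectedness gives every vertex degree at least 1. If all vertices other than `r` had degree
  -- at least 2, the degrees would sum to more than `2 * length (x ∷ xs)`.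
  pendant-exists : ∀ {x xs} → TreeOn (x ∷ xs) → ∃ λ v → v ∈ x ∷ xs × degIn (r ∷ x ∷ xs) v ≡ 1
  pendant-exists {x} {xs} t with any? (λ v → degIn (r ∷ x ∷ xs) v ≟ 1) (x ∷ xs)
  ... | yes found = find found
  ... | no none = contradiction (TreeOn.degreeSum t) (>⇒≢ (+-mono-≤ root≥1 (sum-lower _ 2 (x ∷ xs) others)))
    where
    open TreeOn t
    degree≥1 : ∀ {u v} → u ∈ r ∷ x ∷ xs → v ∈ r ∷ x ∷ xs → u ≢ v → 1 ≤ degIn (r ∷ x ∷ xs) u
    degree≥1 u∈ v∈ u≢v with neighbour (connected _ _ u∈ v∈) u≢v
    ... | w , w∈ , e = count≥1 (G _) w∈ e
    r∉ : ∀ {v} → v ∈ x ∷ xs → r ≢ v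
    r∉ = All.lookup (AllPairs.head unique)
    root≥1 : 1 ≤ degIn (r ∷ x ∷ xs) r
    root≥1 = degree≥1 (here refl) (there (here refl)) (r∉ (here refl))
    others : ∀ {v} → v ∈ x ∷ xs → 2 ≤ degIn (r ∷ x ∷ xs) v
    others v∈ = ≤∧≢⇒< (degree≥1 (there v∈) (here refl) (λ e → r∉ v∈ (sym e)))
      (λ e → none (lose v∈ (sym e)))

  -- `forest u` holds the branches already cut off at `u`, and `D` the degrees in the original
  -- graph. In `total≡`, `eliminate` counts the subtrees that meet a remaining vertex, and the
  -- `total*` term those inside a branch cut off.
  record Pruned (xs : List (Fin n)) (forest : Fin n → List Tree) (D : Fin n → ℕ) : Set where
    field
      order    : Order n
      branches : List Tree
      growing  : Growing G r order
      pendant  : Pendant G r order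
      alive↭   : alive r order ↭ r ∷ xs
      total≡   : eliminate r (rooted* ∘ forest) order + total* (concatMap forest (r ∷ xs)) ≡ whole branches
      root≡    : length branches ≡ D r
      degs↭    : degs* branches ↭ filter (2 ≤?_) (map D xs) ++ degs* (concatMap forest (r ∷ xs))
      ones     : All (_≡ 1) (weights* branches)

  -- A pendant vertex other than `r` is cut off with its forest and hung onto its neighbour. The
  -- hypothesis on `D` persists because the neighbour trades one adjacent vertex for one branch.
  prune : ∀ k xs → length xs ≡ k → TreeOn xs → ∀ forest D →
          (∀ {u} → u ∈ r ∷ xs → D u ≡ length (forest u) + degIn (r ∷ xs) u) →
          All (_≡ 1) (weights* (concatMap forest (r ∷ xs))) → Pruned xs forest D
  prune zero [] _ t forest D hD ones = record
    { order    = []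
    ; branches = forest r
    ; growing  = root
    ; pendant  = root
    ; alive↭   = refl
    ; total≡   = cong (λ ts → rooted* (forest r) + total* ts) (++-identityʳ (forest r))
    ; root≡    = sym (trans (hD (here refl)) (trans (cong (length (forest r) +_) no-loop) (+-identityʳ _)))
    ; degs↭    = ↭-reflexive (cong degs* (sym (++-identityʳ (forest r))))
    ; ones     = subst (λ ts → All (_≡ 1) (weights* ts)) (++-identityʳ (forest r)) ones
    }
    where
    no-loop : degIn (r ∷ []) r ≡ 0
    no-loop = trans (count-∷ (G r) r []) (cong (λ b → indicator b + 0) (loopless r))
  prune (suc k) (x ∷ xs₀) |xs| t forest D hD ones with pendant-exists t
  ... | v , v∈ , degree-v with ∈-∃++ v∈
  ...   | l , l′ , e = grown (count≡1 (G v) ys degree-v′)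
    where
    open TreeOn t
    xs = x ∷ xs₀
    xs′ = l ++ l′
    ys = r ∷ xs′
    xs↭ : xs ↭ v ∷ xs′
    xs↭ = compose (↭-reflexive e) (shift v l l′)
    all↭ : r ∷ xs ↭ v ∷ ys
    all↭ = compose (prep r xs↭) (swap r v refl)
    unique′ : Unique (v ∷ ys)
    unique′ = Unique-↭ all↭ unique
    degIn-∷ : ∀ u → degIn (r ∷ xs) u ≡ indicator (G u v) + degIn ys u
    degIn-∷ u = trans (count-↭ (G u) all↭) (count-∷ (G u) v ys)
    degree-v′ : degIn ys v ≡ 1
    degree-v′ = trans (cong (λ b → indicator b + degIn ys v) (sym (loopless v))) (trans (sym (degIn-∷ v)) degree-v)
    v∉ : v ∉ ys
    v∉ v∈ys = All.lookup (AllPairs.head unique′) v∈ys refl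
    grown : (∃ λ p → p ∈ ys × T (G v p) × (∀ {y} → y ∈ ys → T (G v y) → y ≡ p)) → Pruned xs forest D
    grown (p , p∈ , v-p , only) = record
      { order    = (v , p) ∷ P.order
      ; branches = P.branches
      ; growing  = grow (λ i → v∉ (∈-resp-↭ P.alive↭ i)) (∈-resp-↭ (↭-sym P.alive↭) p∈) v-p P.growing
      ; pendant  = grow (λ i → only (∈-resp-↭ P.alive↭ i)) P.pendant
      ; alive↭   = compose (prep v P.alive↭) (↭-sym all↭)
      ; total≡   = total≡′
      ; root≡    = P.root≡
      ; degs↭    = degs↭′
      ; ones     = P.ones
      }
      where
      fv = forest v
      forest′ = updateAt forest p (bud fv ∷_)
      pool : concatMap forest (r ∷ xs) ↭ fv ++ concatMap forest ys
      pool = concatMap-↭ forest all↭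
      pool′ : concatMap forest′ ys ↭ bud fv ∷ concatMap forest ys
      pool′ = concatMap-updateAt forest p (bud fv) p∈ (AllPairs.tail unique′)
      t′ : TreeOn xs′
      t′ = record
        { unique    = AllPairs.tail unique′
        ; connected = remove-pendant G loopless G-sym {Q = _∈ r ∷ xs} {Q′ = _∈ ys} keep p∈ pendant-v
            (λ i → ∈-resp-↭ (↭-sym all↭) (there i) , λ { refl → v∉ i }) connected
        -- The sum falls by 2: the degree 1 of `v` itself, and 1 at its neighbour.
        ; degreeSum = +-cancelˡ-≡ 2 _ _ (begin
            2 + sum (map (degIn ys) ys)
              ≡⟨ cong₂ (λ a b → a + b + sum (map (degIn ys) ys)) degree-v (trans (count-cong ys (λ u → G-sym u v)) degree-v′) ⟨
            degIn (r ∷ xs) v + count (λ u → G u v) ys + sum (map (degIn ys) ys)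
              ≡⟨ +-assoc (degIn (r ∷ xs) v) _ _ ⟩
            degIn (r ∷ xs) v + (count (λ u → G u v) ys + sum (map (degIn ys) ys))
              ≡⟨ cong (λ a → degIn (r ∷ xs) v + (a + sum (map (degIn ys) ys))) (count-sum (λ u → G u v) ys) ⟩
            degIn (r ∷ xs) v + (sum (map (λ u → indicator (G u v)) ys) + sum (map (degIn ys) ys))
              ≡⟨ cong (degIn (r ∷ xs) v +_) (trans (sum-cong ys degIn-∷) (sum-+ (λ u → indicator (G u v)) (degIn ys) ys)) ⟨
            sum (map (degIn (r ∷ xs)) (v ∷ ys))
              ≡⟨ sum-↭ (map⁺ (degIn (r ∷ xs)) all↭) ⟨
            sum (map (degIn (r ∷ xs)) (r ∷ xs))
              ≡⟨ degreeSum ⟩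
            2 * length xs
              ≡⟨ cong (2 *_) (↭-length xs↭) ⟩
            2 * suc (length xs′)
              ≡⟨ *-suc 2 (length xs′) ⟩
            2 + 2 * length xs′ ∎)
        }
        where
        open ≡-Reasoning
        keep : ∀ {y} → y ∈ r ∷ xs → y ≢ v → y ∈ ys
        keep y∈ y≢v with ∈-resp-↭ all↭ y∈
        ... | here y≡v = contradiction y≡v y≢v
        ... | there i = i
        pendant-v : ∀ {y} → y ∈ r ∷ xs → T (G v y) → y ≡ p
        pendant-v {y} y∈ e with ∈-resp-↭ all↭ y∈
        ... | here refl = ⊥-elim (subst T (loopless v) e)
        ... | there i = only i e
      hD′ : ∀ {u} → u ∈ ys → D u ≡ length (forest′ u) + degIn ys u
      hD′ {u} u∈ = trans (trans (hD (∈-resp-↭ (↭-sym all↭) (there u∈))) (cong (length (forest u) +_) (degIn-∷ u))) shifted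
        where
        shifted : length (forest u) + (indicator (G u v) + degIn ys u) ≡ length (forest′ u) + degIn ys u
        shifted with u Fin.≟ p | G u v in g
        ... | yes refl | true  = trans (+-suc _ _) (cong (λ ts → length ts + degIn ys u) (sym (updateAt-updates u forest)))
        ... | yes refl | false = ⊥-elim (subst T g (edge-sym G loopless G-sym v-p))
        ... | no u≢p   | false = cong (λ ts → length ts + degIn ys u) (sym (updateAt-minimal u p forest u≢p))
        ... | no u≢p   | true  = contradiction (only u∈ (subst T (trans (sym g) (G-sym u v)) _)) u≢p
      weights-split : All (_≡ 1) (weights* fv ++ weights* (concatMap forest ys))
      weights-split = subst (All (_≡ 1)) (weights*-++ fv _) (All-resp-↭ (weights*-↭ pool) ones)
      ones′ : All (_≡ 1) (weights* (concatMap forest′ ys))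
      ones′ = All-resp-↭ (↭-sym (weights*-↭ pool′))
        (All.++⁺ (weights-bud fv (All.++⁻ˡ (weights* fv) weights-split)) (All.++⁻ʳ (weights* fv) weights-split))
      module P = Pruned (prune k xs′ (suc-injective (trans (sym (↭-length xs↭)) |xs|)) t′ forest′ D hD′ ones′)
      weights-step : ∀ u → updateAt (rooted* ∘ forest) p (suc (rooted* fv) *_) u ≡ rooted* (forest′ u)
      weights-step u with u Fin.≟ p
      ... | yes refl = trans (updateAt-updates u (rooted* ∘ forest))
        (trans (cong (λ a → suc a * rooted* (forest u)) (sym (rooted-bud fv))) (cong rooted* (sym (updateAt-updates u forest))))
      ... | no u≢p = trans (updateAt-minimal u p (rooted* ∘ forest) u≢p) (cong rooted* (sym (updateAt-minimal u p forest u≢p)))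
      total≡′ : rooted* fv + eliminate r (updateAt (rooted* ∘ forest) p (suc (rooted* fv) *_)) P.order
                + total* (concatMap forest (r ∷ xs)) ≡ whole P.branches
      total≡′ = begin
        rooted* fv + eliminate r _ P.order + total* (concatMap forest (r ∷ xs))
          ≡⟨ cong₂ (λ a b → rooted* fv + a + b) (eliminate-cong r P.order weights-step)
               (trans (total*-↭ pool) (total*-++ fv _)) ⟩
        rooted* fv + E + (total* fv + S)
          ≡⟨ lemma (rooted* fv) E (total* fv) S ⟩
        E + (whole fv + S)
          ≡⟨ cong (λ a → E + (a + S)) (total-bud fv) ⟨
        E + (total (bud fv) + S)
          ≡⟨ cong (E +_) (total*-↭ pool′) ⟨
        E + total* (concatMap forest′ ys)
          ≡⟨ P.total≡ ⟩
        whole P.branches ∎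
        where
        open ≡-Reasoning
        E = eliminate r (rooted* ∘ forest′) P.order
        S = total* (concatMap forest ys)
        lemma : ∀ a e t s → a + e + (t + s) ≡ e + (a + t + s)
        lemma = solve-∀
      Dv : D v ≡ suc (length fv)
      Dv = trans (hD (there v∈)) (trans (cong (length fv +_) degree-v) (+-comm _ 1))
      degs↭′ : degs* P.branches ↭ filter (2 ≤?_) (map D xs) ++ degs* (concatMap forest (r ∷ xs))
      degs↭′ = begin
        degs* P.branches
          ↭⟨ P.degs↭ ⟩
        F′ ++ degs* (concatMap forest′ ys)
          ↭⟨ ++⁺ˡ F′ (degs*-↭ pool′) ⟩
        F′ ++ degs (bud fv) ++ S
          ≡⟨ cong (λ a → F′ ++ a ++ S) (degs-bud fv) ⟩
        F′ ++ (f ++ degs* fv) ++ S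
          ≡⟨ cong (F′ ++_) (++-assoc f _ _) ⟩
        F′ ++ f ++ degs* fv ++ S
          ↭⟨ shifts F′ f ⟩
        f ++ F′ ++ degs* fv ++ S
          ≡⟨ ++-assoc f F′ _ ⟨
        (f ++ F′) ++ degs* fv ++ S
          ≡⟨ cong₂ _++_ (filter-++ (2 ≤?_) (suc (length fv) ∷ []) (map D xs′)) (degs*-++ fv _) ⟨
        filter (2 ≤?_) (suc (length fv) ∷ map D xs′) ++ degs* (fv ++ concatMap forest ys)
          ≡⟨ cong (λ d → filter (2 ≤?_) (d ∷ map D xs′) ++ degs* (fv ++ concatMap forest ys)) Dv ⟨
        filter (2 ≤?_) (map D (v ∷ xs′)) ++ degs* (fv ++ concatMap forest ys)
          ↭⟨ ++⁺ (filter-↭ (2 ≤?_) (map⁺ D xs↭)) (degs*-↭ pool) ⟨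
        filter (2 ≤?_) (map D xs) ++ degs* (concatMap forest (r ∷ xs)) ∎
        where
        open PermutationReasoning
        F′ = filter (2 ≤?_) (map D xs′)
        f = filter (2 ≤?_) (suc (length fv) ∷ [])
        S = degs* (concatMap forest ys)

reverse-AllPairs : ∀ {A : Set} {R : A → A → Set} {xs} → AllPairs (λ x y → R y x) xs → AllPairs R (reverse xs)
reverse-AllPairs [] = []
reverse-AllPairs {R = R} {x ∷ xs} (p ∷ ps) = subst (AllPairs R) (sym (unfold-reverse x xs))
  (AllPairs.++⁺ (reverse-AllPairs ps) ([] ∷ []) (All.map (_∷ []) (All-resp-↭ (↭-sym (↭-reverse xs)) p)))

all-ones : ∀ {xs} → All (_≡ 1) xs → xs ≡ replicate (length xs) 1
all-ones [] = refl
all-ones (refl ∷ p) = cong (1 ∷_) (all-ones p)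

ones-queue : ∀ d {xs} → All (_≡ 1) xs → Queue d xs
ones-queue d {xs} ones = queue (sorted ones) (All.map (λ e → ≤-reflexive (sym e)) ones)
  (All.map (λ e → ≤-trans (≤-reflexive e) (Π⁺≥1 (take (d ∸ 1) xs))) ones)
  where
  sorted : ∀ {xs} → All (_≡ 1) xs → AllPairs _≤_ xs
  sorted [] = []
  sorted (refl ∷ p) = All.map (λ e → ≤-reflexive (sym e)) p ∷ sorted p

-- A tree with internal degrees `ds`, all at least 2, has `2 + excess ds` leaves.
excess : List ℕ → ℕ
excess ds = sum (map (_∸ 2) ds)

excess-++ : ∀ ds ds′ → excess (ds ++ ds′) ≡ excess ds + excess ds′
excess-++ ds ds′ = trans (cong sum (map-++ (_∸ 2) ds ds′)) (sum-++ (map (_∸ 2) ds) _)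

leaf-count : ∀ ts → All (2 ≤_) (degs* ts) → length (weights* ts) ≡ length ts + excess (degs* ts)
leaf-count [] _ = refl
leaf-count (leaf w ∷ ts) p = cong suc (leaf-count ts p)
leaf-count (node us ∷ ts) (s≤s 1≤us ∷ p) = begin
  length (weights* us ++ weights* ts)
    ≡⟨ length-++ (weights* us) ⟩
  length (weights* us) + length (weights* ts)
    ≡⟨ cong₂ _+_ (leaf-count us (All.++⁻ˡ (degs* us) p)) (leaf-count ts (All.++⁻ʳ (degs* us) p)) ⟩
  length us + excess (degs* us) + (length ts + excess (degs* ts))
    ≡⟨ cong (λ k → k + excess (degs* us) + (length ts + excess (degs* ts))) (m+[n∸m]≡n 1≤us) ⟨
  suc (length us ∸ 1) + excess (degs* us) + (length ts + excess (degs* ts))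
    ≡⟨ lemma (length us ∸ 1) (excess (degs* us)) (length ts) (excess (degs* ts)) ⟩
  suc (length ts) + (length us ∸ 1 + (excess (degs* us) + excess (degs* ts)))
    ≡⟨ cong (λ k → suc (length ts) + (length us ∸ 1 + k)) (excess-++ (degs* us) (degs* ts)) ⟨
  suc (length ts) + (length us ∸ 1 + excess (degs* us ++ degs* ts)) ∎
  where
  open ≡-Reasoning
  lemma : ∀ a b c d → suc a + b + (c + d) ≡ suc c + (a + (b + d))
  lemma = solve-∀

leaf-count-root : ∀ ts → All (2 ≤_) (allDegs ts) → length (weights* ts) ≡ 2 + excess (allDegs ts)
leaf-count-root ts (2≤ts ∷ p) = trans (leaf-count ts p)
  (cong (_+ excess (degs* ts)) (sym (m+[n∸m]≡n 2≤ts)))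

map-filter-degrees : ∀ {A : Set} (f : A → ℕ) xs → map f (filterᵇ (λ x → 2 ≤ᵇ f x) xs) ≡ filter (2 ≤?_) (map f xs)
map-filter-degrees f [] = refl
map-filter-degrees f (x ∷ xs) with 2 ≤ᵇ f x
... | true = cong (f x ∷_) (map-filter-degrees f xs)
... | false = map-filter-degrees f xs

concatMap-[] : ∀ {A B : Set} (xs : List A) → concatMap {B = B} (λ _ → []) xs ≡ []
concatMap-[] [] = refl
concatMap-[] (x ∷ xs) = concatMap-[] xs

-- The upper bound for an arbitrary tree graph

module _ {n : ℕ} (G : Graph n) (tree : IsTree G) where
  loopless = proj₁ tree
  G-sym = proj₁ (proj₂ tree)
  conn = proj₁ (proj₂ (proj₂ (proj₂ tree)))
  edges = proj₂ (proj₂ (proj₂ (proj₂ tree)))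

  tree-bound : ∀ {d ds a} → HasDegSeq G (d ∷ ds) → Linked (λ x y → y ≤ x) (d ∷ ds) → All (2 ≤_) (d ∷ ds) →
               Subtree G ↔ Fin a → a ≤ huffman (reverse (d ∷ ds)) (replicate (2 + excess (d ∷ ds)) 1)
  -- The root is taken at a vertex of degree `d`, which is at least 2: a leaf as root would put a
  -- degree 1 into `allDegs`.
  tree-bound {d} {ds} {a} degSeq desc 2≤ds iso with ∈-map⁻ (deg G) (∈-resp-↭ (↭-sym degSeq) (here refl))
  ... | r , r∈ , d≡ with ∈-∃++ (∈-allFin r)
  ...   | l , l′ , e = begin
    a                                          ≤⟨ count≤length G (subtrees r P.order) listed iso ⟩
    length (subtrees r P.order)                ≡⟨ length-subtrees G r P.growing ⟩
    eliminate r (λ _ → 1) P.order              ≡⟨ +-identityʳ _ ⟨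
    eliminate r (λ _ → 1) P.order + 0          ≡⟨ cong (λ ts → eliminate r (λ _ → 1) P.order + total* ts) (concatMap-[] (r ∷ xs)) ⟨
    eliminate r (λ _ → 1) P.order + total* (concatMap (λ _ → []) (r ∷ xs)) ≡⟨ P.total≡ ⟩
    whole P.branches                           ≤⟨ bound (reverse (d ∷ ds)) (↭-sym (↭-reverse (d ∷ ds)))
                                                    (reverse-AllPairs (Linked⇒AllPairs (λ p q → ≤-trans q p) desc)) ⟩
    huffman (reverse (d ∷ ds)) (weights* P.branches) ≡⟨ cong (huffman (reverse (d ∷ ds)))
                                                    (trans (all-ones P.ones) (cong (λ k → replicate k 1) leaves)) ⟩
    huffman (reverse (d ∷ ds)) (replicate (2 + excess (d ∷ ds)) 1) ∎
    where
    open ≤-Reasoning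
    xs = l ++ l′
    all↭ : allFin n ↭ r ∷ xs
    all↭ = compose (↭-reflexive e) (shift r l l′)
    t : TreeOn G loopless G-sym r xs
    t = record
      { unique    = Unique-↭ all↭ (Unique.allFin⁺ n)
      ; connected = λ u v _ _ → walk-map G (λ {x} _ → ∈-resp-↭ all↭ (∈-allFin x)) (toWalk G (conn u v ∈⊤ ∈⊤))
      ; degreeSum = trans (sum-cong (r ∷ xs) (λ u → count-↭ (G u) (↭-sym all↭)))
          (trans (sum-↭ (map⁺ (deg G) (↭-sym all↭))) (trans (handshake G loopless G-sym)
            (trans (cong (λ k → k + k) (trans edges size)) (cong (length xs +_) (sym (+-identityʳ _))))))
      }
      where
      size : n ∸ 1 ≡ length xs
      size = cong (_∸ 1) (trans (sym (length-tabulate {n = n} (λ i → i))) (↭-length all↭))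
    P : Pruned G loopless G-sym r xs (λ _ → []) (deg G)
    P = prune G loopless G-sym r (length xs) xs refl t (λ _ → []) (deg G) (λ {u} _ → count-↭ (G u) all↭)
      (subst (λ ts → All (_≡ 1) (weights* ts)) (sym (concatMap-[] (r ∷ xs))) [])
    module P = Pruned P
    listed : ∀ U → Nonempty U → ConnectedIn G U → U ∈ subtrees r P.order
    listed U ne c = subtrees-complete G loopless G-sym r P.growing P.pendant U
      (λ {x} _ → ∈-resp-↭ (↭-sym P.alive↭) (∈-resp-↭ all↭ (∈-allFin x))) ne c
    2≤r : 2 ≤ deg G r
    2≤r = subst (2 ≤_) d≡ (All.head 2≤ds)
    degrees : allDegs P.branches ↭ d ∷ ds
    degrees =
      compose (prep _ P.degs↭)
      (compose (↭-reflexive (cong₂ (λ k ts → k ∷ filter (2 ≤?_) (map (deg G) xs) ++ degs* ts) P.root≡ (concatMap-[] (r ∷ xs))))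
      (compose (↭-reflexive (cong (deg G r ∷_) (++-identityʳ _)))
      (compose (↭-reflexive (sym (filter-accept (2 ≤?_) 2≤r)))
      (compose (filter-↭ (2 ≤?_) (map⁺ (deg G) (↭-sym all↭)))
      (compose (↭-reflexive (sym (map-filter-degrees (deg G) (allFin n)))) degSeq)))))
    leaves : length (weights* P.branches) ≡ 2 + excess (d ∷ ds)
    leaves = trans (leaf-count-root P.branches (All-resp-↭ (↭-sym degrees) 2≤ds))
      (cong (2 +_) (sum-↭ (map⁺ (_∸ 2) degrees)))
    -- Generalised over the ascending list because `HuffmanBound` inspects the head, which
    -- `reverse (d ∷ ds)` does not expose.
    bound : ∀ asc → d ∷ ds ↭ asc → AllPairs _≤_ asc → whole P.branches ≤ huffman asc (weights* P.branches)
    bound [] p _ = contradiction (↭-length p) λ ()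
    bound (x ∷ asc) p sorted = huffman-bound x asc sorted (All-resp-↭ p 2≤ds) (weights* P.branches) P.branches
      (ones-queue x P.ones) (hasData (compose degrees p) refl)

-- The greedy tree

-- The default is 0 for child counts and 1 for degrees, so that the leaves, numbered past the end of
-- the list, obey the same formulas as internal vertices.
entry : ℕ → List ℕ → ℕ → ℕ
entry z []       i       = z
entry z (x ∷ xs) zero    = x
entry z (x ∷ xs) (suc i) = entry z xs i

map-entry : ∀ z xs → map (entry z xs) (downFrom (length xs)) ≡ reverse xs
map-entry z xs = begin
  map (entry z xs) (downFrom (length xs))        ≡⟨ cong (map (entry z xs)) (reverse-upTo (length xs)) ⟨
  map (entry z xs) (reverse (upTo (length xs)))  ≡⟨ reverse-map (entry z xs) (upTo (length xs)) ⟩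
  reverse (map (entry z xs) (upTo (length xs)))  ≡⟨ cong reverse (entries xs) ⟩
  reverse xs                                     ∎
  where
  open ≡-Reasoning
  entries : ∀ xs → map (entry z xs) (upTo (length xs)) ≡ xs
  entries [] = refl
  entries (x ∷ xs) = cong (x ∷_) (trans (map-applyUpTo suc (entry z (x ∷ xs)) (length xs))
    (trans (sym (map-upTo (entry z xs) (length xs))) (entries xs)))

sum-take-suc : ∀ xs j → sum (take (suc j) xs) ≡ sum (take j xs) + entry 0 xs j
sum-take-suc [] zero = refl
sum-take-suc [] (suc j) = refl
sum-take-suc (x ∷ xs) zero = +-identityʳ x
sum-take-suc (x ∷ xs) (suc j) = trans (cong (x +_) (sum-take-suc xs j)) (sym (+-assoc x _ _))

-- segment a k lists a + k ∸ 1, …, a.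
segment : ℕ → ℕ → List ℕ
segment a zero    = []
segment a (suc k) = k + a ∷ segment a k

segment-downFrom : ∀ a k → segment a k ++ downFrom a ≡ downFrom (k + a)
segment-downFrom a zero = refl
segment-downFrom a (suc k) = cong (k + a ∷_) (segment-downFrom a k)

segment-∷ʳ : ∀ a k → segment (suc a) k ++ a ∷ [] ≡ segment a (suc k)
segment-∷ʳ a zero = refl
segment-∷ʳ a (suc k) = cong₂ _∷_ (+-suc k a) (segment-∷ʳ a k)

segment-++ : ∀ a k l → segment (k + a) l ++ segment a k ≡ segment a (l + k)
segment-++ a k zero = refl
segment-++ a k (suc l) = cong₂ _∷_ (sym (+-assoc l k a)) (segment-++ a k l)

length-segment : ∀ a k → length (segment a k) ≡ k
length-segment a zero = refl
length-segment a (suc k) = cong suc (length-segment a k)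

segment-≥ : ∀ a k {x} → x ∈ segment a k → a ≤ x
segment-≥ a (suc k) (here refl) = m≤n+m a k
segment-≥ a (suc k) (there x∈) = segment-≥ a k x∈

segment-< : ∀ a k {x} → x ∈ segment a k → x < k + a
segment-< a (suc k) (here refl) = ≤-refl
segment-< a (suc k) (there x∈) = m≤n⇒m≤1+n (segment-< a k x∈)

count-none : ∀ {A : Set} (f : A → Bool) xs → (∀ x → f x ≡ false) → count f xs ≡ 0
count-none f [] h = refl
count-none f (x ∷ xs) h = trans (count-∷ f x xs) (cong₂ _+_ (cong indicator (h x)) (count-none f xs h))

count-one : ∀ {A : Set} (f : A → Bool) {p xs} → p ∈ xs → Unique xs → f p ≡ true → (∀ x → f x ≡ true → x ≡ p) → count f xs ≡ 1
count-one f {p} {x ∷ xs} (here refl) (p∉ ∷ _) fp only = trans (count-∷ f x xs) (cong₂ _+_ (cong indicator fp) (rest xs p∉))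
  where
  rest : ∀ xs → All (p ≢_) xs → count f xs ≡ 0
  rest [] _ = refl
  rest (y ∷ ys) (p≢y ∷ h) with f y in e
  ... | true = contradiction (sym (only y e)) p≢y
  ... | false = rest ys h
count-one f {p} {x ∷ xs} (there p∈) (x∉ ∷ u) fp only with f x in e
... | true = contradiction (only x e) (All.lookup x∉ p∈)
... | false = count-one f p∈ u fp only

count-map : ∀ {A B : Set} (f : B → Bool) (g : A → B) xs → count f (map g xs) ≡ count (f ∘ g) xs
count-map f g xs = trans (count-sum f (map g xs)) (trans (cong sum (sym (map-∘ xs))) (sym (count-sum (f ∘ g) xs)))

allFin-suc : ∀ n → allFin (suc n) ≡ zero ∷ map suc (allFin n)
allFin-suc n = cong (zero ∷_) (sym (map-tabulate (λ i → i) suc))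

-- The test is `isChildOf` for vertex `suc v`, where `suc v ≤ᵇ b` computes to `v <ᵇ b`.
count-interval : ∀ n a b → b ≤ n → count (λ v → (a <ᵇ suc (Fin.toℕ v)) ∧ (Fin.toℕ v <ᵇ b)) (allFin n) ≡ b ∸ a
count-interval n a zero _ = trans (count-none _ (allFin n) (λ v → ∧-zeroʳ (a <ᵇ suc (Fin.toℕ v)))) (sym (0∸n≡0 a))
count-interval (suc n) a (suc b) (s≤s b≤n) = trans (cong (count (interval a)) (allFin-suc n)) (shifted a)
  where
  interval : ℕ → Fin (suc n) → Bool
  interval a v = (a <ᵇ suc (Fin.toℕ v)) ∧ (Fin.toℕ v <ᵇ suc b)
  shifted : ∀ a → count (interval a) (zero ∷ map suc (allFin n)) ≡ suc b ∸ a
  shifted zero = cong suc (trans (count-map (interval 0) suc (allFin n)) (count-interval n 0 b b≤n))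
  shifted (suc a) = trans (count-map (interval (suc a)) suc (allFin n)) (count-interval n a b b≤n)

filter-entries : ∀ xs n (f : ℕ → ℕ) → All (2 ≤_) xs → length xs ≤ n → (∀ i → f i ≡ entry 1 xs i) →
                 filter (2 ≤?_) (map (f ∘ Fin.toℕ) (allFin n)) ≡ xs
filter-entries [] n f _ _ e = none (allFin n)
  where
  none : ∀ vs → filter (2 ≤?_) (map (f ∘ Fin.toℕ) vs) ≡ []
  none [] = refl
  none (v ∷ vs) rewrite e (Fin.toℕ v) = none vs
filter-entries (x ∷ xs) (suc n) f (2≤x ∷ p) (s≤s h) e = begin
  filter (2 ≤?_) (map (f ∘ Fin.toℕ) (allFin (suc n)))
    ≡⟨ cong (λ vs → filter (2 ≤?_) (map (f ∘ Fin.toℕ) vs)) (allFin-suc n) ⟩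
  filter (2 ≤?_) (f 0 ∷ map (f ∘ Fin.toℕ) (map suc (allFin n)))
    ≡⟨ cong₂ (λ y ys → filter (2 ≤?_) (y ∷ ys)) (e 0) (sym (map-∘ (allFin n))) ⟩
  filter (2 ≤?_) (x ∷ map (f ∘ suc ∘ Fin.toℕ) (allFin n))
    ≡⟨ filter-accept (2 ≤?_) 2≤x ⟩
  x ∷ filter (2 ≤?_) (map (f ∘ suc ∘ Fin.toℕ) (allFin n))
    ≡⟨ cong (x ∷_) (filter-entries xs n (f ∘ suc) p h (e ∘ suc)) ⟩
  x ∷ xs ∎
  where open ≡-Reasoning

module _ {n : ℕ} (r : Fin n) where

  alive-batch : ∀ j xs o → alive r (map (_, j) xs ++ o) ≡ xs ++ alive r o
  alive-batch j [] o = refl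
  alive-batch j (x ∷ xs) o = cong (x ∷_) (alive-batch j xs o)

  growing-batch : ∀ {G : Graph n} j xs {o} → Growing G r o → Unique (xs ++ alive r o) → j ∈ alive r o →
                  (∀ {x} → x ∈ xs → T (G x j)) → Growing G r (map (_, j) xs ++ o)
  growing-batch j [] g u j∈ h = g
  growing-batch j (x ∷ xs) {o} g (x∉ ∷ u) j∈ h = grow
    (λ i → All.lookup x∉ (subst (x ∈_) (alive-batch j xs o) i) refl)
    (subst (j ∈_) (sym (alive-batch j xs o)) (∈-++⁺ʳ xs j∈))
    (h (here refl)) (growing-batch j xs g u j∈ (h ∘ there))

  -- Removing all children of `j` amounts to one Huffman merge: the sum of their weights is charged
  -- and their `Π⁺` passes to `j`. As `j` is not among them, their weights do not change on the way.
  eliminate-batch : ∀ w j xs o → j ∉ xs →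
    eliminate r w (map (_, j) xs ++ o) ≡ sum (map w xs) + eliminate r (updateAt w j (Π⁺ (map w xs) *_)) o
  eliminate-batch w j [] o _ = eliminate-cong r o λ x → same x
    where
    same : ∀ x → w x ≡ updateAt w j (1 *_) x
    same x with x Fin.≟ j
    ... | yes refl = sym (trans (updateAt-updates x w) (+-identityʳ _))
    ... | no x≢j = sym (updateAt-minimal x j w x≢j)
  eliminate-batch w j (x ∷ xs) o j∉ = begin
    w x + eliminate r w′ (map (_, j) xs ++ o)
      ≡⟨ cong (w x +_) (eliminate-batch w′ j xs o (j∉ ∘ there)) ⟩
    w x + (sum (map w′ xs) + eliminate r (updateAt w′ j (Π⁺ (map w′ xs) *_)) o)
      ≡⟨ cong (λ ys → w x + (sum ys + eliminate r (updateAt w′ j (Π⁺ ys *_)) o)) (unchanged xs (j∉ ∘ there)) ⟩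
    w x + (sum (map w xs) + eliminate r (updateAt w′ j (Π⁺ (map w xs) *_)) o)
      ≡⟨ cong (λ e → w x + (sum (map w xs) + e)) (eliminate-cong r o combined) ⟩
    w x + (sum (map w xs) + eliminate r (updateAt w j (Π⁺ (map w (x ∷ xs)) *_)) o)
      ≡⟨ +-assoc (w x) _ _ ⟨
    w x + sum (map w xs) + eliminate r (updateAt w j (Π⁺ (map w (x ∷ xs)) *_)) o ∎
    where
    open ≡-Reasoning
    w′ = updateAt w j (suc (w x) *_)
    unchanged : ∀ ys → j ∉ ys → map w′ ys ≡ map w ys
    unchanged [] _ = refl
    unchanged (y ∷ ys) j∉ys = cong₂ _∷_ (updateAt-minimal y j w λ { refl → j∉ys (here refl) }) (unchanged ys (j∉ys ∘ there))
    combined : ∀ y → updateAt w′ j (Π⁺ (map w xs) *_) y ≡ updateAt w j (Π⁺ (map w (x ∷ xs)) *_) y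
    combined y with y Fin.≟ j
    ... | yes refl = trans (updateAt-updates y w′) (trans (cong (Π⁺ (map w xs) *_) (updateAt-updates y w))
            (trans (lemma (Π⁺ (map w xs)) (w x) (w y)) (sym (updateAt-updates y w))))
      where lemma : ∀ a b c → a * (suc b * c) ≡ suc b * a * c
            lemma = solve-∀
    ... | no y≢j = trans (updateAt-minimal y j w′ y≢j) (trans (updateAt-minimal y j w y≢j) (sym (updateAt-minimal y j w y≢j)))

  growing-connected : ∀ {G : Graph n} → (∀ u → G u u ≡ false) → (∀ u v → G u v ≡ G v u) →
                      ∀ {o} → Growing G r o → Connected G (_∈ alive r o)
  growing-connected _ _ root u v (here refl) (here refl) = here (here refl)
  growing-connected {G} loopless G-sym (grow _ p∈ e g) u v u∈ v∈ = walk-map G join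
    (add-vertex G loopless G-sym (growing-connected loopless G-sym g) p∈ e u v (divide u∈) (divide v∈))
    where
    join : ∀ {v x} {xs : List (Fin n)} → x ≡ v ⊎ x ∈ xs → x ∈ v ∷ xs
    join (inj₁ e) = here e
    join (inj₂ i) = there i
    divide : ∀ {v x} {xs : List (Fin n)} → x ∈ v ∷ xs → x ≡ v ⊎ x ∈ xs
    divide (here e) = inj₁ e
    divide (there i) = inj₂ i

¬T⇒false : ∀ {b} → ¬ T b → b ≡ false
¬T⇒false {false} _ = refl
¬T⇒false {true} h = contradiction _ h

T⇒true : ∀ {b} → T b → b ≡ true
T⇒true {true} _ = refl

count-∨ : ∀ {A : Set} (f g : A → Bool) xs → (∀ x → ¬ (T (f x) × T (g x))) →
          count (λ x → f x ∨ g x) xs ≡ count f xs + count g xs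
count-∨ f g xs disjoint = begin
  count (λ x → f x ∨ g x) xs                          ≡⟨ count-sum _ xs ⟩
  sum (map (λ x → indicator (f x ∨ g x)) xs)           ≡⟨ sum-cong xs (λ x → additive (f x) (g x) (disjoint x)) ⟩
  sum (map (λ x → indicator (f x) + indicator (g x)) xs) ≡⟨ sum-+ (indicator ∘ f) (indicator ∘ g) xs ⟩
  sum (map (indicator ∘ f) xs) + sum (map (indicator ∘ g) xs) ≡⟨ cong₂ _+_ (count-sum f xs) (count-sum g xs) ⟨
  count f xs + count g xs                             ∎
  where
  open ≡-Reasoning
  additive : ∀ a b → ¬ (T a × T b) → indicator (a ∨ b) ≡ indicator a + indicator b
  additive true true h = contradiction (_ , _) h
  additive true false _ = refl
  additive false b _ = refl

entry-pred : ∀ {xs} → All (2 ≤_) xs → ∀ i → suc (entry 0 (map (_∸ 1) xs) i) ≡ entry 1 xs i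
entry-pred [] i = refl
entry-pred (s≤s _ ∷ p) zero = refl
entry-pred (_ ∷ p) (suc i) = entry-pred p i

entry-≥ : ∀ {z k xs} → All (k ≤_) xs → ∀ {i} → i < length xs → k ≤ entry z xs i
entry-≥ (p ∷ ps) {zero} _ = p
entry-≥ (p ∷ ps) {suc i} (s≤s i<) = entry-≥ ps i<

sum-take≤ : ∀ xs j → sum (take j xs) ≤ sum xs
sum-take≤ [] zero = z≤n
sum-take≤ [] (suc j) = z≤n
sum-take≤ (x ∷ xs) zero = z≤n
sum-take≤ (x ∷ xs) (suc j) = +-monoʳ-≤ x (sum-take≤ xs j)

-- Every vertex but the root is a child: `length ds` internal vertices and `2 + excess (d ∷ ds)`
-- leaves.
child-total : ∀ {d ds} → All (2 ≤_) (d ∷ ds) → sum (childCounts (d ∷ ds)) ≡ length ds + (2 + excess (d ∷ ds))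
child-total {d} {ds} (2≤d ∷ p) = begin
  d + sum (map (_∸ 1) ds)                      ≡⟨ cong₂ _+_ (sym (m+[n∸m]≡n 2≤d)) (rest p) ⟩
  2 + (d ∸ 2) + (length ds + excess ds)        ≡⟨ lemma (d ∸ 2) (length ds) (excess ds) ⟩
  length ds + (2 + (d ∸ 2 + excess ds))        ∎
  where
  open ≡-Reasoning
  lemma : ∀ a b c → 2 + a + (b + c) ≡ b + (2 + (a + c))
  lemma = solve-∀
  rest : ∀ {xs} → All (2 ≤_) xs → sum (map (_∸ 1) xs) ≡ length xs + excess xs
  rest [] = refl
  rest {suc (suc x) ∷ xs} (_ ∷ p) = cong suc (trans (cong (x +_) (rest p)) (swap-+ x (length xs) (excess xs)))
    where swap-+ : ∀ a b c → a + (b + c) ≡ b + (a + c)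
          swap-+ = solve-∀
  rest {suc zero ∷ xs} (s≤s () ∷ p)

module Greedy (d : ℕ) (ds : List ℕ) (2≤ds : All (2 ≤_) (d ∷ ds)) where

  counts : List ℕ
  counts = childCounts (d ∷ ds)

  M m : ℕ
  M = sum counts
  m = suc (length ds)

  G : Graph (suc M)
  G = greedyTree (d ∷ ds)

  -- `C j` leaves out the children of `j` itself, so these are numbered from `suc (C j)` to
  -- `C (suc j)`.
  C c : ℕ → ℕ
  C j = sum (take j counts)
  c j = entry 0 counts j

  child : ℕ → ℕ → Bool
  child = isChildOf (d ∷ ds)

  C-suc : ∀ j → C (suc j) ≡ C j + c j
  C-suc = sum-take-suc counts

  C≤M : ∀ j → C j ≤ M
  C≤M = sum-take≤ counts

  length-counts : length counts ≡ m
  length-counts = cong suc (length-map (_∸ 1) ds)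

  C-all : ∀ {j} → m ≤ j → C j ≡ M
  C-all {j} m≤j = cong sum (take-all j counts (subst (_≤ j) (sym length-counts) m≤j))

  c≥1 : ∀ {j} → j < m → 1 ≤ c j
  c≥1 {j} j<m = entry-≥ (≤-trans (s≤s z≤n) (All.head 2≤ds) ∷ All.map⁺ (All.map (∸-monoˡ-≤ 1) (All.tail 2≤ds)))
    (subst (j <_) (sym length-counts) j<m)

  -- Each internal vertex has a child, so the numbering of children never falls behind: vertex `j`
  -- is numbered before its own children are.
  C≥ : ∀ j → j ≤ m → j ≤ C j
  C≥ zero _ = z≤n
  C≥ (suc j) j<m = subst (suc j ≤_) (trans (+-comm (c j) (C j)) (sym (C-suc j))) (+-mono-≤ (c≥1 j<m) (C≥ j (<⇒≤ j<m)))

  C-mono : ∀ {i j} → i ≤ j → C i ≤ C j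
  C-mono {i} {j} i≤j = mono {i} {j} (≤⇒≤′ i≤j)
    where
    mono : ∀ {i j} → i ≤′ j → C i ≤ C j
    mono {i} (≤′-reflexive refl) = ≤-refl
    mono {i} {suc j} (≤′-step h) = ≤-trans (mono {i} {j} h) (subst (C j ≤_) (sym (C-suc j)) (m≤m+n _ _))

  child⁺ : ∀ i j → C j < i → i ≤ C (suc j) → T (child i j)
  child⁺ i j l u = Equivalence.from T-∧ (<⇒<ᵇ l , ≤⇒≤ᵇ u)

  child⁻ : ∀ i j → T (child i j) → C j < i × i ≤ C (suc j)
  child⁻ i j t = <ᵇ⇒< (C j) i (proj₁ both) , ≤ᵇ⇒≤ i (C (suc j)) (proj₂ both)
    where both = Equivalence.to T-∧ t

  child-< : ∀ i j → T (child i j) → j < i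
  child-< i j t with child⁻ i j t | j <? m
  ... | l , u | yes j<m = ≤-<-trans (C≥ j (<⇒≤ j<m)) l
  ... | l , u | no j≮m = contradiction (<-≤-trans l u)
    (≤⇒≯ (≤-trans (C≤M (suc j)) (≤-reflexive (sym (C-all {j} (≮⇒≥ j≮m))))))

  child-functional : ∀ i j k → T (child i j) → T (child i k) → j ≡ k
  child-functional i j k t s = ≤-antisym (before j k t s) (before k j s t)
    where
    before : ∀ j k → T (child i j) → T (child i k) → j ≤ k
    before j k t s = ≮⇒≥ λ k<j →
      <⇒≱ (proj₁ (child⁻ i j t)) (≤-trans (proj₂ (child⁻ i k s)) (C-mono {suc k} {j} k<j))

  parent : ∀ {i} → 1 ≤ i → ∀ k → i ≤ C k → ∃ λ j → j < k × T (child i j)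
  parent 1≤i zero i≤ = contradiction (≤-trans 1≤i i≤) λ ()
  parent {i} 1≤i (suc k) i≤ with i ≤? C k
  ... | yes i≤Ck = let j , j<k , t = parent 1≤i k i≤Ck in j , m≤n⇒m≤1+n j<k , t
  ... | no i≰Ck = k , ≤-refl , child⁺ i k (≰⇒> i≰Ck) i≤

  -- Cutting off at `M` makes the numbering total on ℕ; it is faithful up to `M`.
  vertex : ℕ → Fin (suc M)
  vertex i = Fin.fromℕ< (s≤s (m⊓n≤n i M))

  toℕ-vertex : ∀ {i} → i ≤ M → Fin.toℕ (vertex i) ≡ i
  toℕ-vertex i≤M = trans (Fin.toℕ-fromℕ< _) (m≤n⇒m⊓n≡m i≤M)

  vertex-toℕ : ∀ u → vertex (Fin.toℕ u) ≡ u
  vertex-toℕ u = Fin.toℕ-injective (toℕ-vertex (s≤s⁻¹ (Fin.toℕ<n u)))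

  vertex-injective : ∀ {i j} → i ≤ M → j ≤ M → vertex i ≡ vertex j → i ≡ j
  vertex-injective i≤ j≤ e = trans (sym (toℕ-vertex i≤)) (trans (cong Fin.toℕ e) (toℕ-vertex j≤))

  r : Fin (suc M)
  r = vertex 0

  children : ℕ → List (Fin (suc M))
  children j = map vertex (segment (suc (C j)) (c j))

  order : ℕ → Order (suc M)
  order zero    = []
  order (suc j) = map (_, vertex j) (children j) ++ order j

  ∈-downFrom : ∀ {i n} → i < n → i ∈ downFrom n
  ∈-downFrom {i} {suc n} i<1+n with i ≟ n
  ... | yes refl = here refl
  ... | no i≢n = there (∈-downFrom (≤∧≢⇒< (s≤s⁻¹ i<1+n) i≢n))

  alive-suc : ∀ j → children j ++ map vertex (downFrom (suc (C j))) ≡ map vertex (downFrom (suc (C (suc j))))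
  alive-suc j = trans (sym (map-++ vertex (segment (suc (C j)) (c j)) _))
    (cong (map vertex) (trans (segment-downFrom (suc (C j)) (c j))
      (cong downFrom (trans (+-suc (c j) (C j)) (cong suc (trans (+-comm (c j) (C j)) (sym (C-suc j))))))))

  alive-order : ∀ j → alive r (order j) ≡ map vertex (downFrom (suc (C j)))
  alive-order zero = refl
  alive-order (suc j) = trans (alive-batch r (vertex j) (children j) (order j))
    (trans (cong (children j ++_) (alive-order j)) (alive-suc j))

  vertices-unique : ∀ n → n ≤ suc M → Unique (map vertex (downFrom n))
  vertices-unique zero _ = []
  vertices-unique (suc n) n<M = All.map⁺ (All.tabulate λ {k} k∈ e →
      <-irrefl (vertex-injective (<⇒≤ (<-≤-trans (below n k∈) (s≤s⁻¹ n<M))) (s≤s⁻¹ n<M) (sym e)) (below n k∈))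
    ∷ vertices-unique n (<⇒≤ n<M)
    where
    below : ∀ n {k} → k ∈ downFrom n → k < n
    below (suc n) (here refl) = ≤-refl
    below (suc n) (there k∈) = m≤n⇒m≤1+n (below n k∈)

  growing : ∀ j → j ≤ m → Growing G r (order j)
  growing zero _ = root
  growing (suc j) j<m = growing-batch r {G = G} (vertex j) (children j) (growing j (<⇒≤ j<m))
    (subst Unique (sym (trans (cong (children j ++_) (alive-order j)) (alive-suc j)))
      (vertices-unique (suc (C (suc j))) (s≤s (C≤M (suc j)))))
    (subst (vertex j ∈_) (sym (alive-order j)) (∈-map⁺ vertex (∈-downFrom (s≤s j≤Cj))))
    λ x∈ → let i , i∈ , e = ∈-map⁻ vertex x∈ in subst (λ x → T (G x (vertex j))) (sym e) (edge i∈)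
    where
    j≤Cj : j ≤ C j
    j≤Cj = C≥ j (<⇒≤ j<m)
    below : ∀ {i} → i ∈ segment (suc (C j)) (c j) → i ≤ C (suc j)
    below i∈ = s≤s⁻¹ (≤-trans (segment-< _ (c j) i∈)
      (≤-reflexive (trans (+-suc (c j) (C j)) (cong suc (trans (+-comm (c j) (C j)) (sym (C-suc j)))))))
    edge : ∀ {i} → i ∈ segment (suc (C j)) (c j) → T (G (vertex i) (vertex j))
    edge {i} i∈ rewrite toℕ-vertex (≤-trans (below i∈) (C≤M (suc j))) | toℕ-vertex (≤-trans j≤Cj (C≤M j)) =
      Equivalence.from T-∨ (inj₁ (child⁺ i j (segment-≥ _ (c j) i∈) (below i∈)))

  degree : ℕ → ℕ
  degree = entry 1 (d ∷ ds)

  -- The segment lists the vertices from `C (suc j)` down to `suc j`, and their weights are the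
  -- current queue. The children of `j` form its front; once they are merged, `j`, which still has
  -- weight 1, receives their product and joins the queue at the end. Thus removal in reverse
  -- breadth-first order performs exactly the merges of `huffman`.
  eliminate-order : ∀ j → j < m → ∀ w → (∀ {i} → i ≤ j → w (vertex i) ≡ 1) →
    eliminate r w (order (suc j))
    ≡ huffman (map degree (downFrom (suc j))) (map (w ∘ vertex) (segment (suc j) (C (suc j) ∸ j)))
  eliminate-order zero 0<m w ones = begin
    eliminate r w (map (_, r) xs ++ [])                   ≡⟨ eliminate-batch r w r xs [] r∉ ⟩
    sum (map w xs) + updateAt w r (Π⁺ (map w xs) *_) r    ≡⟨ cong (sum (map w xs) +_) (updateAt-updates r {Π⁺ (map w xs) *_} w) ⟩
    sum (map w xs) + Π⁺ (map w xs) * w r                  ≡⟨ cong (λ k → sum (map w xs) + Π⁺ (map w xs) * k) (ones z≤n) ⟩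
    sum (map w xs) + Π⁺ (map w xs) * 1                    ≡⟨ cong (sum (map w xs) +_) (*-identityʳ _) ⟩
    sum (map w xs) + Π⁺ (map w xs)                        ≡⟨ +-comm (sum (map w xs)) _ ⟩
    Π⁺ (map w xs) + sum (map w xs)                        ≡⟨ cong (λ ws → Π⁺ ws + sum ws) same ⟩
    Π⁺ ws + sum ws                                        ∎
    where
    open ≡-Reasoning
    xs = children 0
    ws = map (w ∘ vertex) (segment 1 (C 1))
    same : map w xs ≡ ws
    same = trans (sym (map-∘ (segment 1 d))) (cong (λ k → map (w ∘ vertex) (segment 1 k)) (sym (+-identityʳ d)))
    r∉ : r ∉ xs
    r∉ r∈ with ∈-map⁻ vertex r∈
    ... | i , i∈ , e = contradiction (segment-≥ 1 d i∈) (<⇒≱ (≤-reflexive (cong suc (sym (vertex-injective z≤n i≤M e)))))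
      where
      i≤M : i ≤ M
      i≤M = ≤-trans (s≤s⁻¹ (≤-trans (segment-< 1 d i∈) (≤-reflexive (+-comm d 1)))) (m≤m+n d _)
  eliminate-order (suc j) j<m w ones = begin
    eliminate r w (map (_, vertex (suc j)) xs ++ order (suc j))
      ≡⟨ eliminate-batch r w (vertex (suc j)) xs (order (suc j)) v∉ ⟩
    sum (map w xs) + eliminate r w′ (order (suc j))
      ≡⟨ cong (sum (map w xs) +_) (eliminate-order j (<⇒≤ j<m) w′ ones′) ⟩
    sum (map w xs) + huffman (map degree (downFrom (suc j))) (map (w′ ∘ vertex) (segment (suc j) (C (suc j) ∸ j)))
      ≡⟨ cong₂ (λ a b → sum a + huffman (map degree (downFrom (suc j))) b) (sym front) next ⟩
    huffman (map degree (downFrom (suc (suc j)))) ws ∎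
    where
    open ≡-Reasoning
    v≤C : suc j ≤ C (suc j)
    v≤C = C≥ (suc j) (<⇒≤ j<m)
    v≤M : suc j ≤ M
    v≤M = ≤-trans v≤C (C≤M (suc j))
    k = C (suc j) ∸ suc j
    k+v : k + suc j ≡ C (suc j)
    k+v = m∸n+n≡m v≤C
    xs = children (suc j)
    w′ = updateAt w (vertex (suc j)) (Π⁺ (map w xs) *_)
    ws = map (w ∘ vertex) (segment (suc (suc j)) (C (suc (suc j)) ∸ suc j))
    C-step : C (suc (suc j)) ≡ c (suc j) + C (suc j)
    C-step = trans (C-suc (suc j)) (+-comm (C (suc j)) _)
    front-≤M : ∀ {i} → i ∈ segment (suc (C (suc j))) (c (suc j)) → i ≤ M
    front-≤M i∈ = ≤-trans (s≤s⁻¹ (≤-trans (segment-< _ (c (suc j)) i∈)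
      (≤-reflexive (trans (+-suc (c (suc j)) _) (cong suc (sym C-step)))))) (C≤M (suc (suc j)))
    v∉ : vertex (suc j) ∉ xs
    v∉ v∈ with ∈-map⁻ vertex v∈
    ... | i , i∈ , e = <-irrefl (vertex-injective v≤M (front-≤M i∈) e)
      (≤-<-trans v≤C (segment-≥ _ (c (suc j)) i∈))
    ones′ : ∀ {i} → i ≤ j → w′ (vertex i) ≡ 1
    ones′ {i} i≤j = trans (updateAt-minimal (vertex i) (vertex (suc j)) w
        λ e → <-irrefl (vertex-injective (≤-trans (m≤n⇒m≤1+n i≤j) v≤M) v≤M e) (s≤s i≤j))
      (ones (m≤n⇒m≤1+n i≤j))
    back = map (w ∘ vertex) (segment (suc (suc j)) k)
    ws-split : ws ≡ map w xs ++ back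
    ws-split = trans (cong (map (w ∘ vertex)) (trans (cong (segment (suc (suc j))) sizes)
        (trans (sym (segment-++ (suc (suc j)) k (c (suc j))))
          (cong (λ a → segment a (c (suc j)) ++ segment (suc (suc j)) k) (trans (+-suc k (suc j)) (cong suc k+v))))))
      (trans (map-++ (w ∘ vertex) (segment (suc (C (suc j))) (c (suc j))) _)
        (cong (_++ back) (map-∘ (segment (suc (C (suc j))) (c (suc j))))))
      where
      sizes : C (suc (suc j)) ∸ suc j ≡ c (suc j) + k
      sizes = trans (cong (_∸ suc j) C-step) (+-∸-assoc (c (suc j)) v≤C)
    |xs| : length (map w xs) ≡ degree (suc j) ∸ 1
    |xs| = trans (length-map w xs) (trans (length-map vertex (segment (suc (C (suc j))) (c (suc j))))
      (trans (length-segment (suc (C (suc j))) (c (suc j))) (cong (_∸ 1) (entry-pred (All.tail 2≤ds) j))))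
    front : take (degree (suc j) ∸ 1) ws ≡ map w xs
    front = trans (cong₂ take (sym |xs|) ws-split) (take-length (map w xs) back)
    rear : drop (degree (suc j) ∸ 1) ws ≡ back
    rear = trans (cong₂ drop (sym |xs|) ws-split) (drop-length (map w xs) back)
    segment-k : segment (suc j) (C (suc j) ∸ j) ≡ segment (suc (suc j)) k ++ suc j ∷ []
    segment-k = trans (cong (segment (suc j)) (∸-suc-pred v≤C)) (sym (segment-∷ʳ (suc j) k))
      where
      ∸-suc-pred : ∀ {a b} → suc a ≤ b → b ∸ a ≡ suc (b ∸ suc a)
      ∸-suc-pred {a} {suc b} (s≤s a≤b) = +-∸-assoc 1 a≤b
    next : map (w′ ∘ vertex) (segment (suc j) (C (suc j) ∸ j))
           ≡ drop (degree (suc j) ∸ 1) ws ++ Π⁺ (take (degree (suc j) ∸ 1) ws) ∷ []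
    next = trans (cong (map (w′ ∘ vertex)) segment-k) (trans (map-++ (w′ ∘ vertex) (segment (suc (suc j)) k) _)
      (cong₂ (λ a b → a ++ b ∷ []) (trans (map-cong-local (All.tabulate unchanged)) (sym rear))
        (trans (updateAt-updates (vertex (suc j)) w)
          (trans (cong (Π⁺ (map w xs) *_) (ones ≤-refl)) (trans (*-identityʳ _) (cong Π⁺ (sym front)))))))
      where
      unchanged : ∀ {i} → i ∈ segment (suc (suc j)) k → w′ (vertex i) ≡ w (vertex i)
      unchanged {i} i∈ = updateAt-minimal (vertex i) (vertex (suc j)) w
        λ e → <-irrefl (sym (vertex-injective i≤M v≤M e)) (segment-≥ _ k i∈)
        where
        i≤M : i ≤ M
        i≤M = ≤-trans (s≤s⁻¹ (≤-trans (segment-< _ k i∈) (≤-reflexive (trans (+-suc k (suc j)) (cong suc k+v))))) (C≤M (suc j))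

  greedy-value : length (subtrees r (order m)) ≡ huffman (reverse (d ∷ ds)) (replicate (2 + excess (d ∷ ds)) 1)
  greedy-value = begin
    length (subtrees r (order m))                   ≡⟨ length-subtrees G r (growing m ≤-refl) ⟩
    eliminate r (λ _ → 1) (order m)                 ≡⟨ eliminate-order (length ds) ≤-refl (λ _ → 1) (λ _ → refl) ⟩
    huffman (map degree (downFrom m)) (map (λ _ → 1) (segment m (C m ∸ length ds)))
      ≡⟨ cong₂ huffman (map-entry 1 (d ∷ ds)) (ones (segment m (C m ∸ length ds))) ⟩
    huffman (reverse (d ∷ ds)) (replicate (length (segment m (C m ∸ length ds))) 1)
      ≡⟨ cong (λ k → huffman (reverse (d ∷ ds)) (replicate k 1)) size ⟩
    huffman (reverse (d ∷ ds)) (replicate (2 + excess (d ∷ ds)) 1) ∎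
    where
    open ≡-Reasoning
    ones : ∀ (xs : List ℕ) → map (λ _ → 1) xs ≡ replicate (length xs) 1
    ones [] = refl
    ones (x ∷ xs) = cong (1 ∷_) (ones xs)
    size : length (segment m (C m ∸ length ds)) ≡ 2 + excess (d ∷ ds)
    size = trans (length-segment m _) (trans (cong (_∸ length ds) (trans (C-all ≤-refl) (child-total 2≤ds)))
      (m+n∸m≡n (length ds) _))

  -- Degrees, edges and connectedness of the greedy tree

  loopless-greedy : ∀ u → G u u ≡ false
  loopless-greedy u = ¬T⇒false λ t → loop (Equivalence.to T-∨ t)
    where
    loop : ¬ (T (child (Fin.toℕ u) (Fin.toℕ u)) ⊎ T (child (Fin.toℕ u) (Fin.toℕ u)))
    loop (inj₁ t) = <-irrefl refl (child-< (Fin.toℕ u) (Fin.toℕ u) t)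
    loop (inj₂ t) = <-irrefl refl (child-< (Fin.toℕ u) (Fin.toℕ u) t)

  sym-greedy : ∀ u v → G u v ≡ G v u
  sym-greedy u v = ∨-comm (child (Fin.toℕ u) (Fin.toℕ v)) _

  childV : Fin (suc M) → Fin (suc M) → Bool
  childV u v = child (Fin.toℕ u) (Fin.toℕ v)

  hasParent : ℕ → ℕ
  hasParent zero = 0
  hasParent (suc _) = 1

  count-parents : ∀ u → count (childV u) (allFin (suc M)) ≡ hasParent (Fin.toℕ u)
  count-parents zero = count-none _ (allFin (suc M)) λ _ → refl
  count-parents u@(suc u′) with parent {Fin.toℕ u} (s≤s z≤n) m (subst (Fin.toℕ u ≤_) (sym (C-all ≤-refl)) (s≤s⁻¹ (Fin.toℕ<n u)))
  ... | j , j<m , t = count-one (childV u) (∈-allFin (vertex j)) (Unique.allFin⁺ (suc M))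
      (T⇒true (subst (λ i → T (child (Fin.toℕ u) i)) (sym toℕ-j) t))
      (λ v e → Fin.toℕ-injective (trans (child-functional (Fin.toℕ u) (Fin.toℕ v) j (subst T (sym e) _) t) (sym toℕ-j)))
    where
    toℕ-j : Fin.toℕ (vertex j) ≡ j
    toℕ-j = toℕ-vertex (≤-trans (C≥ j (<⇒≤ j<m)) (C≤M j))

  count-children : ∀ u → count (λ v → childV v u) (allFin (suc M)) ≡ c (Fin.toℕ u)
  count-children u = begin
    count (λ v → childV v u) (allFin (suc M))
      ≡⟨ cong (count (λ v → childV v u)) (allFin-suc M) ⟩
    count (λ v → childV v u) (map suc (allFin M))
      ≡⟨ count-map (λ v → childV v u) suc (allFin M) ⟩
    count (λ v → childV (suc v) u) (allFin M)
      ≡⟨ count-interval M (C j) (C (suc j)) (C≤M (suc j)) ⟩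
    C (suc j) ∸ C j
      ≡⟨ trans (cong (_∸ C j) (C-suc j)) (m+n∸m≡n (C j) (c j)) ⟩
    c j ∎
    where
    open ≡-Reasoning
    j = Fin.toℕ u

  deg-greedy : ∀ u → deg G u ≡ hasParent (Fin.toℕ u) + c (Fin.toℕ u)
  deg-greedy u = trans (count-∨ (childV u) (λ v → childV v u) (allFin (suc M))
      λ v (t , s) → <-asym (child-< (Fin.toℕ u) (Fin.toℕ v) t) (child-< (Fin.toℕ v) (Fin.toℕ u) s))
    (cong₂ _+_ (count-parents u) (count-children u))

  degSeq-greedy : HasDegSeq G (d ∷ ds)
  degSeq-greedy = ↭-reflexive (begin
    map (deg G) (filterᵇ (λ v → 2 ≤ᵇ deg G v) (allFin (suc M)))
      ≡⟨ map-filter-degrees (deg G) (allFin (suc M)) ⟩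
    filter (2 ≤?_) (map (deg G) (allFin (suc M)))
      ≡⟨ cong (filter (2 ≤?_)) (map-cong deg-greedy (allFin (suc M))) ⟩
    filter (2 ≤?_) (map ((λ i → hasParent i + c i) ∘ Fin.toℕ) (allFin (suc M)))
      ≡⟨ filter-entries (d ∷ ds) (suc M) (λ i → hasParent i + c i) 2≤ds (m≤n⇒m≤1+n (≤-trans (C≥ m ≤-refl) (C≤M m))) entries ⟩
    d ∷ ds ∎)
    where
    open ≡-Reasoning
    entries : ∀ i → hasParent i + c i ≡ degree i
    entries zero = refl
    entries (suc i) = entry-pred (All.tail 2≤ds) i

  -- The end of an edge with the larger number is the child, so edges correspond to vertices other
  -- than the root, each having one parent.
  edges-greedy : numEdges G ≡ M
  edges-greedy = begin
    sum (map (λ i → count (up i) (allFin (suc M))) (allFin (suc M)))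
      ≡⟨ sum-cong (allFin (suc M)) (λ i → count-cong (allFin (suc M)) (up-child i)) ⟩
    sum (map (λ i → count (λ j → childV j i) (allFin (suc M))) (allFin (suc M)))
      ≡⟨ double-count childV (allFin (suc M)) (allFin (suc M)) ⟨
    sum (map (λ j → count (childV j) (allFin (suc M))) (allFin (suc M)))
      ≡⟨ sum-cong (allFin (suc M)) count-parents ⟩
    sum (map (hasParent ∘ Fin.toℕ) (allFin (suc M)))
      ≡⟨ cong (sum ∘ map (hasParent ∘ Fin.toℕ)) (allFin-suc M) ⟩
    sum (map (hasParent ∘ Fin.toℕ) (map suc (allFin M)))
      ≡⟨ ones (allFin M) ⟩
    length (allFin M)
      ≡⟨ length-tabulate (λ i → i) ⟩
    M ∎
    where
    open ≡-Reasoning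
    up : Fin (suc M) → Fin (suc M) → Bool
    up i j = (Fin.toℕ i <ᵇ Fin.toℕ j) ∧ G i j
    up-child : ∀ i j → up i j ≡ childV j i
    up-child i j with childV j i in e | childV i j in e′
    ... | true | _ = cong₂ _∧_ (T⇒true (<⇒<ᵇ (child-< (Fin.toℕ j) (Fin.toℕ i) (subst T (sym e) _)))) (∨-zeroʳ _)
    ... | false | false = ∧-zeroʳ _
    ... | false | true = cong (_∧ true) (¬T⇒false λ lt →
            <-asym (child-< (Fin.toℕ i) (Fin.toℕ j) (subst T (sym e′) _)) (<ᵇ⇒< (Fin.toℕ i) (Fin.toℕ j) lt))
    ones : ∀ {k} (vs : List (Fin k)) → sum (map (hasParent ∘ Fin.toℕ) (map suc vs)) ≡ length vs
    ones [] = refl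
    ones (v ∷ vs) = cong suc (ones vs)

  tree-greedy : IsTree G
  tree-greedy = loopless-greedy , sym-greedy , s≤s z≤n , connected , edges-greedy
    where
    listed : ∀ u → u ∈ alive r (order m)
    listed u = subst (u ∈_) (sym (alive-order m)) (subst (_∈ map vertex (downFrom (suc (C m)))) (vertex-toℕ u)
      (∈-map⁺ vertex (∈-downFrom (subst (λ k → Fin.toℕ u < suc k) (sym (C-all ≤-refl)) (Fin.toℕ<n u)))))
    connected : ConnectedIn G ⊤
    connected u v _ _ = fromWalk G (walk-map G (λ _ → ∈⊤)
      (growing-connected r loopless-greedy sym-greedy (growing m ≤-refl) u v (listed u) (listed v)))

  greedy-bound : ∀ {b} → Subtree G ↔ Fin b → huffman (reverse (d ∷ ds)) (replicate (2 + excess (d ∷ ds)) 1) ≤ b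
  greedy-bound iso = subst (_≤ _) greedy-value (length≤count G (subtrees r (order m))
    (unique-subtrees G r (growing m ≤-refl))
    (subtrees-sound G loopless-greedy sym-greedy r (growing m ≤-refl)) iso)

theorem3p2 : (ds : List ℕ) → 0 < length ds → Linked (λ a b → b ≤ a) ds → All (2 ≤_) ds
    → Σ ℕ (λ n → Σ (Graph n) (λ T → IsTree T × HasDegSeq T ds))
    → IsTree (greedyTree ds) × HasDegSeq (greedyTree ds) ds
    × ((n : ℕ) (T : Graph n) → IsTree T → HasDegSeq T ds → (a b : ℕ)
    → Subtree T ↔ Fin a → Subtree (greedyTree ds) ↔ Fin b → a ≤ b)
theorem3p2 (d ∷ ds) _ sorted 2≤ds _ = tree-greedy , degSeq-greedy ,
  λ n T tree degSeq a b isoT isoG → ≤-trans (tree-bound T tree degSeq sorted 2≤ds isoT) (greedy-bound isoG)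
  where open Greedy d ds 2≤ds
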